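{- Let $G=(V,E)$ be any finite undirected graph with at least one edge, and let $n=|V|$. Run the Ranking algorithm on $G$ (defined in the context). Then $$\frac{\mathbb{E}[\text{number of nodes matched by Ranking}]}{\text{number of nodes covered by a maximum matching of } G}\;\ge\;\frac{2(5-\sqrt{7})}{9}\approx 0.523,$$ where the expectation is over the uniformly random permutation chosen by Ranking.
   Context: A permutation of $V$ is a bijection $\sigma:V\to[n]$ where $[n]=\{1,\dots,n\}$; $\sigma(u)$ is the rank of $u$ (smaller rank = higher priority). The Ranking algorithm chooses $\sigma$ uniformly at random among all $n!$ permutations and forms a list $L$ of all unordered pairs of distinct nodes, ordered lexicographically according to $\sigma$: write each pair as $\{u,v\}$ with $\sigma(u)<\sigma(v)$; pair $\{u_1,v_1\}$ precedes $\{u_2,v_2\}$ iff $\sigma(u_1)<\sigma(u_2)$, or $u_1=u_2$ and $\sigma(v_1)<\sigma(v_2)$. Initially all nodes are unmatched. The pairs are probed in the order of $L$; when $\{u,v\}$ is probed, if both $u,v$ are currently unmatched and $\{u,v\}\in E$, then $u$ and $v$ become matched to each other; otherwise nothing happens. The result is a (maximal) matching of $G$. The edges of $G$ are not used in choosing $L$. -}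

module Defs where

open import Data.Nat using (ℕ; zero; suc; _+_; _*_; _∸_; _^_; _≤_)
open import Data.Bool using (Bool; true; false; _∧_; _∨_; not; if_then_else_)
open import Data.Fin using (Fin; _≟_)
open import Data.List using (List; []; _∷_; _++_; map; concatMap; filter; foldl; length; allFin)
open import Data.Nat.ListAction using (sum)
import Data.Bool.ListAction as BL
open import Data.List.Relation.Unary.All using (All)
open import Data.List.Relation.Unary.Unique.Propositional using (Unique)
open import Data.Vec using (Vec; lookup)
import Data.Vec as Vec
open import Data.Product using (_×_; _,_; ∃; ∃₂)
open import Relation.Binary.PropositionalEquality using (_≡_)
open import Relation.Nullary.Decidable using (⌊_⌋)

record Graph (n : ℕ) : Set where
  field
    adj       : Fin n → Fin n → Bool
    adj-sym   : ∀ u v → adj u v ≡ adj v u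
    adj-irrefl : ∀ u → adj u u ≡ false
open Graph public

HasEdge : ∀ {n} → Graph n → Set
HasEdge G = ∃₂ λ u v → adj G u v ≡ true

endpoints : ∀ {n} → List (Fin n × Fin n) → List (Fin n)
endpoints = concatMap (λ { (u , v) → u ∷ v ∷ [] })

IsMatching : ∀ {n} → Graph n → List (Fin n × Fin n) → Set
IsMatching G M = All (λ { (u , v) → adj G u v ≡ true }) M × Unique (endpoints M)

IsMaximumMatching : ∀ {n} → Graph n → List (Fin n × Fin n) → Set
IsMaximumMatching G M =
  IsMatching G M × (∀ M′ → IsMatching G M′ → length M′ ≤ length M)

coveredNodes : ∀ {n} → List (Fin n × Fin n) → ℕ
coveredNodes M = 2 * length M

-- Permutations σ : V → [n] (0-based ranks), represented by the vector of
-- ranks σ(u).  All of them are obtained by enumerating all maps V → Fin n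
-- and keeping the injective (= bijective, by finiteness) ones.

allVecs : (k m : ℕ) → List (Vec (Fin m) k)
allVecs zero    m = Vec.[] ∷ []
allVecs (suc k) m = concatMap (λ i → map (i Vec.∷_) (allVecs k m)) (allFin m)

isInjective : ∀ {n} → Vec (Fin n) n → Bool
isInjective {n} σ =
  BL.all (λ u → BL.all (λ v → ⌊ u ≟ v ⌋ ∨ not ⌊ lookup σ u ≟ lookup σ v ⌋)
                                     (allFin n))
                (allFin n)

permutations : (n : ℕ) → List (Vec (Fin n) n)
permutations n = filter (λ σ → Data.Bool.T? (isInjective σ)) (allVecs n n)
  where import Data.Bool

byRank : ∀ {n} → Vec (Fin n) n → List (Fin n)
byRank {n} σ = concatMap (λ r → filter (λ u → lookup σ u ≟ r) (allFin n)) (allFin n)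

Status : ℕ → Set
Status n = Fin n → Bool     -- true = matched

probe : ∀ {n} → Graph n → Status n → Fin n → Fin n → Status n
probe G m u v =
  if adj G u v ∧ not (m u) ∧ not (m v)
  then (λ w → ⌊ w ≟ u ⌋ ∨ ⌊ w ≟ v ⌋ ∨ m w)
  else m

-- probe the pairs of L in lexicographic order: for each node u by increasing
-- rank, the pairs {u,v} with σ(u) < σ(v), by increasing σ(v).
runRanking : ∀ {n} → Graph n → List (Fin n) → Status n → Status n
runRanking G []       m = m
runRanking G (u ∷ vs) m = runRanking G vs (foldl (λ m′ v → probe G m′ u v) m vs)

rankingMatched : ∀ {n} → Graph n → Vec (Fin n) n → ℕ
rankingMatched {n} G σ =
  length (filter (λ u → Data.Bool.T? (runRanking G (byRank σ) (λ _ → false) u)) (allFin n))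
  where import Data.Bool

-- sum over all n! permutations (expectation = this / n!)
totalMatched : ∀ {n} → Graph n → ℕ
totalMatched {n} G = sum (map (rankingMatched G) (permutations n))

-- The rational x / y is ≥ 2(5 - √7)/9  (for y > 0):
--   x/y ≥ 2(5-√7)/9  ⇔  2√7·y ≥ 10y - 9x  ⇔  (10y ∸ 9x)² ≤ 28 y².

RatioAtLeastBound : ℕ → ℕ → Set
RatioAtLeastBound x y = (10 * y ∸ 9 * x) ^ 2 ≤ 28 * y ^ 2

{-# OPTIONS --safe #-}
-- Fix a matching M covering the node set C and let x t be the number of
-- permutations in which the node of rank t is matched (ranks start at 0).
-- A free node can be moved to a later rank without changing the matching, so x
-- is nonincreasing.  For u in C with M-partner u*, compare a permutation with
-- the one in which u is moved to rank t: if u is free in both, then u* is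
-- matched to a node of rank below t.  Charging u to that node gives the
-- evolving constraint  n! |C| ≤ (n − t) x t + 2 ∑_{j<t} x j.
--
-- Boundary constraint  2 n! |C| ≤ 2 n x (n−1) + 3 ∑ x :  call a matched u in C
-- double if it becomes free when moved to the last rank while u* is free.
-- Blocking a double node u changes the matching along an alternating path from
-- u to u*, and u* is the only free neighbour of u.  If u and its partner are
-- both double, the last matched edge on this path has no double end, and with
-- the direction in which the path traverses it, it determines u.  Hence at most
-- half of the matched nodes are double, in every permutation.
--
-- With S = ∑ x / (n! |C|) and w = n x (n−1) / (n! |C|), the evolving
-- constraints give 2 S ≥ 1 + w², and w ≥ 1 − 3 S / 2 then yields
-- 9 S² − 20 S + 8 ≤ 0.
module Submission where

open import Defs
open import Data.Nat using (ℕ; zero; suc; _<ᵇ_; _+_; _*_; _∸_; _^_; _≤_; _<_; z≤n; s≤s; NonZero; >-nonZero)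
import Data.Nat.Properties as ℕ
open import Data.Nat.DivMod using (_/_; _%_; m≡m%n+[m/n]*n; m%n<n)
open import Data.Nat.Induction using (<-wellFounded)
open import Data.Nat.ListAction using (sum)
open import Data.Nat.ListAction.Properties using (sum-↭)
open import Data.Nat.Tactic.RingSolver using (solve-∀)
open import Data.Bool as Bool using (Bool; true; false; _∧_; _∨_; not; if_then_else_; T; T?)
open import Data.Bool.Properties using (not-¬; not-injective; T-≡)
open import Data.Fin as Fin using (Fin; _≟_; toℕ; punchIn; punchOut)
import Data.Fin.Properties as Fin
open import Data.Fin.Permutation as Perm using (Permutation; _⟨$⟩ʳ_; _⟨$⟩ˡ_; permutation)
open import Data.List using (List; []; _∷_; _++_; map; foldl; length; allFin; filter; tabulate)
open import Data.List.Properties using (map-∘; map-cong)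
open import Data.List.Membership.Propositional using (_∈_; lose)
open import Data.List.Membership.Propositional.Properties
open import Data.List.Membership.Propositional.Properties.WithK using (unique∧set⇒bag)
open import Data.List.Relation.Binary.BagAndSetEquality using (∼bag⇒↭)
open import Data.List.Relation.Binary.Permutation.Propositional using (_↭_)
import Data.List.Relation.Binary.Permutation.Propositional.Properties as ↭
open import Data.List.Relation.Unary.Any using (here; there)
open import Data.List.Relation.Unary.All as All using (All; []; _∷_)
import Data.List.Relation.Unary.All.Properties as All
open import Data.List.Relation.Unary.AllPairs using (AllPairs; []; _∷_)
import Data.List.Relation.Unary.AllPairs.Properties as AllPairs
open import Data.List.Relation.Unary.Unique.Propositional using (Unique)
import Data.List.Relation.Unary.Unique.Propositional.Properties as Unique
open import Data.Product using (_×_; _,_; ∃; ∃₂; proj₁; proj₂)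
open import Data.Sum as Sum using (_⊎_; inj₁; inj₂)
open import Data.Vec as Vec using (Vec; lookup)
import Data.Vec.Properties as Vec
open import Function using (_∘_; id; mk⇔; Equivalence)
open import Induction.WellFounded using (Acc; acc)
open import Relation.Nullary using (yes; no; contradiction; does)
open import Relation.Nullary.Decidable using (⌊_⌋; _×-dec_)
open import Relation.Binary.Definitions using (tri<; tri≈; tri>)
open import Relation.Binary.PropositionalEquality
open import Algebra.Properties.CommutativeMonoid.Sum ℕ.+-0-commutativeMonoid
  using (sum-cong-≗; ∑-distrib-+; ∑-comm; sum-permute) renaming (sum to Σ)

-- Boolean node states, and pairs of states that differ in one node.

_∌_ : ∀ {A : Set} → (A → Bool) → A → Set
s ∌ w = s w ≡ false

_∋_ : ∀ {A : Set} → (A → Bool) → A → Set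
s ∋ w = s w ≡ true

true≢false : ∀ {A : Set} {b} → b ≡ true → b ≡ false → A
true≢false refl ()

∋⇒≢ : ∀ {A : Set} {s : A → Bool} {u w} → s ∋ u → s ∌ w → u ≢ w
∋⇒≢ p q refl = true≢false p q

∅ : ∀ {n} → Status n
∅ _ = false

add : ∀ {n} → Status n → Fin n → Status n
add s x w = ⌊ w ≟ x ⌋ ∨ s w

add-self : ∀ {n} (s : Status n) x → add s x ∋ x
add-self s x with x ≟ x
... | yes _ = refl
... | no x≢x = contradiction refl x≢x

add-other : ∀ {n} (s : Status n) {x w} → w ≢ x → add s x w ≡ s w
add-other s {x} {w} w≢x with w ≟ x
... | yes w≡x = contradiction w≡x w≢x
... | no _ = refl

-- Every probe preserves Diff (diff-probe): the node in which the two states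
-- differ travels along an alternating path.
DiffAt : ∀ {n} → Status n → Status n → Fin n → Set
DiffAt s t d = s d ≡ not (t d) × (∀ w → w ≢ d → s w ≡ t w)

Diff : ∀ {n} → Status n → Status n → Set
Diff s t = ∃ (DiffAt s t)

diff-unique : ∀ {n} {s t : Status n} {e} → Diff s t → s e ≡ not (t e) → DiffAt s t e
diff-unique {e = e} (d , sd , same) se with e ≟ d
... | yes refl = sd , same
... | no e≢d = contradiction se (not-¬ (same e e≢d))

diff-add : ∀ {n} (s : Status n) {x} → s ∌ x → DiffAt s (add s x) x
diff-add s {x} sx = trans sx (cong not (sym (add-self s x))) , λ w w≢x → sym (add-other s w≢x)

-- Greedy probing of pairs.

module Greedy {n : ℕ} (G : Graph n) where

  Pairs : Set
  Pairs = List (Fin n × Fin n)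

  active : Status n → Fin n → Fin n → Bool
  active s u v = adj G u v ∧ not (s u) ∧ not (s v)

  adj⇒≢ : ∀ {u v} → adj G u v ≡ true → u ≢ v
  adj⇒≢ {u} p refl = true≢false p (adj-irrefl G u)

  active-≡ : ∀ {s u v a b c} → adj G u v ≡ a → s u ≡ b → s v ≡ c → active s u v ≡ a ∧ not b ∧ not c
  active-≡ refl refl refl = refl

  record Hit (s : Status n) (u v : Fin n) : Set where
    field
      edge    : adj G u v ≡ true
      free₁   : s ∌ u
      free₂   : s ∌ v
      filled₁ : probe G s u v ∋ u
      filled₂ : probe G s u v ∋ v
      isActive : active s u v ≡ true
  open Hit

  -- A failed probe is recorded both as a computed value and as a refutation; the latter ends in
  -- `true ≡ false` so that `true≢false refl` closes any goal.
  data ProbeView (s : Status n) (u v : Fin n) (s′ : Status n) : Set where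
    hit  : active s u v ≡ true → adj G u v ≡ true → s ∌ u → s ∌ v →
           s′ ∋ u → s′ ∋ v → (∀ w → w ≢ u → w ≢ v → s′ w ≡ s w) → ProbeView s u v s′
    miss : active s u v ≡ false → (adj G u v ≡ true → s ∌ u → s ∌ v → true ≡ false) →
           s′ ≗ s → ProbeView s u v s′

  probeView : ∀ s u v → ProbeView s u v (probe G s u v)
  probeView s u v with adj G u v in a | s u in p | s v in q
  ... | false | _     | _     = miss (active-≡ {s} {u} {v} a refl refl) (λ a′ _ _ → trans (sym a′) a) (λ _ → refl)
  ... | true  | true  | _     = miss (active-≡ {s} {u} {v} a p refl) (λ _ p′ _ → trans (sym p) p′) (λ _ → refl)
  ... | true  | false | true  = miss (active-≡ {s} {u} {v} a p q) (λ _ _ q′ → trans (sym q) q′) (λ _ → refl)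
  ... | true  | false | false = hit (active-≡ {s} {u} {v} a p q) a p q left right other
    where
    s′ : Status n
    s′ w = ⌊ w ≟ u ⌋ ∨ ⌊ w ≟ v ⌋ ∨ s w
    left : s′ ∋ u
    left with u ≟ u
    ... | yes _ = refl
    ... | no u≢u = contradiction refl u≢u
    right : s′ ∋ v
    right with v ≟ u | v ≟ v
    ... | yes _ | _ = refl
    ... | no _ | yes _ = refl
    ... | no _ | no v≢v = contradiction refl v≢v
    other : ∀ w → w ≢ u → w ≢ v → s′ w ≡ s w
    other w w≢u w≢v with w ≟ u | w ≟ v
    ... | yes w≡u | _ = contradiction w≡u w≢u
    ... | no _ | yes w≡v = contradiction w≡v w≢v
    ... | no _ | no _ = refl

  active⇒hit : ∀ {s u v} → active s u v ≡ true → Hit s u v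
  active⇒hit {s} {u} {v} a with probeView s u v
  ... | hit _ uv su sv s′u s′v _ = record
    { edge = uv ; free₁ = su ; free₂ = sv ; filled₁ = s′u ; filled₂ = s′v ; isActive = a }
  ... | miss b _ _ = true≢false a b

  ⇒hit : ∀ {s u v} → adj G u v ≡ true → s ∌ u → s ∌ v → Hit s u v
  ⇒hit {s} {u} {v} a p q = active⇒hit (active-≡ {s} {u} {v} a p q)

  probe-cong : ∀ {s t} → s ≗ t → ∀ u v → probe G s u v ≗ probe G t u v
  probe-cong {s} {t} e u v w with active s u v | active t u v
    | cong₂ (λ a b → adj G u v ∧ not a ∧ not b) (e u) (e v)
  ... | true  | .true  | refl = cong (λ a → ⌊ w ≟ u ⌋ ∨ ⌊ w ≟ v ⌋ ∨ a) (e w)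
  ... | false | .false | refl = e w

  probe-mono : ∀ s u v {w} → s ∋ w → probe G s u v ∋ w
  probe-mono s u v {w} p with probeView s u v
  ... | miss _ _ e = trans (e w) p
  ... | hit _ _ su sv _ _ other = trans (other w (∋⇒≢ {s = s} p su) (∋⇒≢ {s = s} p sv)) p

  probe-free : ∀ s u v {w} → probe G s u v ∌ w → s ∌ w
  probe-free s u v {w} p with s w in q
  ... | false = refl
  ... | true = true≢false (probe-mono s u v q) p

  -- If exactly one of the two probes matches its pair, the states disagree on an end of the pair,
  -- so `d` is that end. Afterwards they agree there and disagree on the other end.
  diff-probe : ∀ {s t} → Diff s t → ∀ u v → Diff (probe G s u v) (probe G t u v)
  diff-probe {s} {t} (d , sd , same) u v with probeView s u v | probeView t u v
  ... | miss _ _ e | miss _ _ f =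
    d , trans (e d) (trans sd (cong not (sym (f d)))) , λ w w≢d → trans (e w) (trans (same w w≢d) (sym (f w)))
  ... | hit _ _ su sv s'u s'v es | hit _ _ tu tv t'u t'v et = d , trans (es d d≢u d≢v) (trans sd (cong not (sym (et d d≢u d≢v)))) , other
    where
    d≢u : d ≢ u
    d≢u refl = true≢false (trans sd (cong not tu)) su
    d≢v : d ≢ v
    d≢v refl = true≢false (trans sd (cong not tv)) sv
    other : ∀ w → w ≢ d → _
    other w w≢d with w ≟ u | w ≟ v
    ... | yes refl | _ = trans s'u (sym t'u)
    ... | no _ | yes refl = trans s'v (sym t'v)
    ... | no w≢u | no w≢v = trans (es w w≢u w≢v) (trans (same w w≢d) (sym (et w w≢u w≢v)))
  ... | hit _ a su sv s'u s'v es | miss _ m f with u ≟ d | v ≟ d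
  ...   | yes refl | yes refl = contradiction refl (adj⇒≢ a)
  ...   | no u≢d | no v≢d = true≢false refl (m a (trans (sym (same u u≢d)) su) (trans (sym (same v v≢d)) sv))
  ...   | yes refl | no v≢d = v , trans s'v (cong not (sym (trans (f v) (trans (sym (same v v≢d)) sv)))) , other
    where
    other : ∀ w → w ≢ v → _
    other w w≢v with w ≟ u
    ... | yes refl = trans s'u (sym (trans (f w) (not-injective (trans (sym sd) su))))
    ... | no w≢u = trans (es w w≢u w≢v) (trans (same w w≢u) (sym (f w)))
  ...   | no u≢d | yes refl = u , trans s'u (cong not (sym (trans (f u) (trans (sym (same u u≢d)) su)))) , other
    where
    other : ∀ w → w ≢ u → _
    other w w≢u with w ≟ v
    ... | yes refl = trans s'v (sym (trans (f w) (not-injective (trans (sym sd) sv))))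
    ... | no w≢v = trans (es w w≢u w≢v) (trans (same w w≢v) (sym (f w)))
  diff-probe {s} {t} (d , sd , same) u v | miss _ m f | hit _ a tu tv t'u t'v et with u ≟ d | v ≟ d
  ...   | yes refl | yes refl = contradiction refl (adj⇒≢ a)
  ...   | no u≢d | no v≢d = true≢false refl (m a (trans (same u u≢d) tu) (trans (same v v≢d) tv))
  ...   | yes refl | no v≢d = v , trans (f v) (trans (same v v≢d) (trans tv (cong not (sym t'v)))) , other
    where
    other : ∀ w → w ≢ v → _
    other w w≢v with w ≟ u
    ... | yes refl = trans (f w) (trans sd (trans (cong not tu) (sym t'u)))
    ... | no w≢u = trans (f w) (trans (same w w≢u) (sym (et w w≢u w≢v)))
  ...   | no u≢d | yes refl = u , trans (f u) (trans (same u u≢d) (trans tu (cong not (sym t'u)))) , other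
    where
    other : ∀ w → w ≢ u → _
    other w w≢u with w ≟ v
    ... | yes refl = trans (f w) (trans sd (trans (cong not tv) (sym t'v)))
    ... | no w≢v = trans (f w) (trans (same w w≢v) (sym (et w w≢u w≢v)))

  -- Runs over a list of pairs and the matchings they produce.

  run : Pairs → Status n → Status n
  run []             s = s
  run ((u , v) ∷ L) s = run L (probe G s u v)

  run-++ : ∀ L L′ s → run (L ++ L′) s ≡ run L′ (run L s)
  run-++ []      L′ s = refl
  run-++ (_ ∷ L) L′ s = run-++ L L′ _

  run-cong : ∀ L {s t} → s ≗ t → run L s ≗ run L t
  run-cong []            e = e
  run-cong ((u , v) ∷ L) e = run-cong L (probe-cong e u v)

  run-mono : ∀ L s {w} → s ∋ w → run L s ∋ w
  run-mono []            s p = p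
  run-mono ((u , v) ∷ L) s p = run-mono L _ (probe-mono s u v p)

  run-free : ∀ L s {w} → run L s ∌ w → s ∌ w
  run-free L s {w} p with s w in q
  ... | false = refl
  ... | true = true≢false (run-mono L s q) p

  diff-run : ∀ L {s t} → Diff s t → Diff (run L s) (run L t)
  diff-run []            δ = δ
  diff-run ((u , v) ∷ L) δ = diff-run L (diff-probe δ u v)

  -- The partner of y in the matching produced from s; an unmatched node is
  -- its own partner.
  mate : Pairs → Status n → Fin n → Fin n
  mate []            s y = y
  mate ((u , v) ∷ L) s y =
    if active s u v ∧ ⌊ y ≟ u ⌋ then v else
    if active s u v ∧ ⌊ y ≟ v ⌋ then u else mate L (probe G s u v) y

  data MateView (s : Status n) (u v : Fin n) (L : Pairs) (y : Fin n) : Set where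
    left  : Hit s u v → y ≡ u → mate ((u , v) ∷ L) s y ≡ v → MateView s u v L y
    right : Hit s u v → y ≡ v → mate ((u , v) ∷ L) s y ≡ u → MateView s u v L y
    later : (Hit s u v → y ≢ u × y ≢ v) → probe G s u v y ≡ s y →
            mate ((u , v) ∷ L) s y ≡ mate L (probe G s u v) y → MateView s u v L y

  mateView : ∀ s u v L y → MateView s u v L y
  mateView s u v L y with active s u v in a | y ≟ u in yu | y ≟ v in yv
  ... | true | yes p | _ = left (active⇒hit {s} {u} {v} a) p (lem a yu)
    where lem : active s u v ≡ true → (y ≟ u) ≡ yes p → mate ((u , v) ∷ L) s y ≡ v
          lem a e rewrite a | e = refl
  ... | true | no p | yes q = right (active⇒hit {s} {u} {v} a) q (lem a yu yv)
    where lem : active s u v ≡ true → (y ≟ u) ≡ no p → (y ≟ v) ≡ yes q → mate ((u , v) ∷ L) s y ≡ u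
          lem a e f rewrite a | e | f = refl
  ... | true | no p | no q = later (λ _ → p , q) (state (probeView s u v)) (lem a yu yv)
    where
    state : ProbeView s u v (probe G s u v) → probe G s u v y ≡ s y
    state (hit _ _ _ _ _ _ f) = f y p q
    state (miss _ _ f) = f y
    lem : active s u v ≡ true → (y ≟ u) ≡ no p → (y ≟ v) ≡ no q → mate ((u , v) ∷ L) s y ≡ mate L (probe G s u v) y
    lem a e f rewrite e | f | a = refl
  ... | false | _ | _ = later (λ e → true≢false (isActive e) a) (state (probeView s u v)) (lem a)
    where
    state : ProbeView s u v (probe G s u v) → probe G s u v y ≡ s y
    state (hit e _ _ _ _ _ _) = true≢false e a
    state (miss _ _ f) = f y
    lem : active s u v ≡ false → mate ((u , v) ∷ L) s y ≡ mate L (probe G s u v) y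
    lem a rewrite a = refl

  mate-blocked : ∀ L {s y} → s ∋ y → mate L s y ≡ y
  mate-blocked []            p = refl
  mate-blocked ((u , v) ∷ L) {s} {y} p with mateView s u v L y
  ... | left a refl _  = true≢false p (free₁ a)
  ... | right a refl _ = true≢false p (free₂ a)
  ... | later _ e m    = trans m (mate-blocked L (trans e p))

  mate-free : ∀ L {s y} → mate L s y ≢ y → s ∌ mate L s y
  mate-free []            p = contradiction refl p
  mate-free ((u , v) ∷ L) {s} {y} p with mateView s u v L y
  ... | left a _ m  = trans (cong s m) (free₂ a)
  ... | right a _ m = trans (cong s m) (free₁ a)
  ... | later _ _ m = trans (cong s m) (probe-free s u v (mate-free L (p ∘ trans m)))

  mate-invol : ∀ L {s} y → mate L s (mate L s y) ≡ y
  mate-invol []            y = refl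
  mate-invol ((u , v) ∷ L) {s} y with mateView s u v L y
  mate-invol ((u , v) ∷ L) {s} y | left a refl m with mateView s u v L v
  ... | left _ v≡u _ = contradiction (sym v≡u) (adj⇒≢ (edge a))
  ... | right _ _ m′ = trans (cong (mate ((u , v) ∷ L) s) m) m′
  ... | later f _ _  = contradiction refl (proj₂ (f a))
  mate-invol ((u , v) ∷ L) {s} y | right a refl m with mateView s u v L u
  ... | left _ _ m′  = trans (cong (mate ((u , v) ∷ L) s) m) m′
  ... | right _ u≡v _ = contradiction u≡v (adj⇒≢ (edge a))
  ... | later f _ _  = contradiction refl (proj₁ (f a))
  mate-invol ((u , v) ∷ L) {s} y | later f _ m
    with mate L (probe G s u v) y ≟ y
  ... | yes e = trans (cong (mate ((u , v) ∷ L) s) (trans m e)) (trans m e)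
  ... | no e with mateView s u v L (mate L (probe G s u v) y)
  ...   | left a z≡u _  = true≢false (filled₁ a)
                            (trans (cong (probe G s u v) (sym z≡u)) (mate-free L e))
  ...   | right a z≡v _ = true≢false (filled₂ a)
                            (trans (cong (probe G s u v) (sym z≡v)) (mate-free L e))
  ...   | later _ _ m′  = trans (cong (mate ((u , v) ∷ L) s) m) (trans m′ (mate-invol L y))

  mate-adj : ∀ L {s y} → mate L s y ≢ y → adj G y (mate L s y) ≡ true
  mate-adj []            p = contradiction refl p
  mate-adj ((u , v) ∷ L) {s} {y} p with mateView s u v L y
  ... | left a refl m  = trans (cong (adj G y) m) (edge a)
  ... | right a refl m = trans (cong (adj G y) m) (trans (adj-sym G v u) (edge a))
  ... | later _ _ m    = trans (cong (adj G y) m) (mate-adj L (p ∘ trans m))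

  matched⇒mate≢ : ∀ L {s y} → s ∌ y → run L s ∋ y → mate L s y ≢ y
  matched⇒mate≢ []            p q = true≢false q p
  matched⇒mate≢ ((u , v) ∷ L) {s} {y} p q with mateView s u v L y
  ... | left a refl m  = λ e → adj⇒≢ (edge a) (trans (sym e) m)
  ... | right a refl m = λ e → adj⇒≢ (edge a) (trans (sym m) e)
  ... | later _ e m    = λ k → matched⇒mate≢ L (trans e p) q (trans (sym m) k)

  free⇒mate≡ : ∀ L {s y} → run L s ∌ y → mate L s y ≡ y
  free⇒mate≡ []            p = refl
  free⇒mate≡ ((u , v) ∷ L) {s} {y} p with mateView s u v L y
  ... | left a refl _  = true≢false (run-mono L _ (filled₁ a)) p
  ... | right a refl _ = true≢false (run-mono L _ (filled₂ a)) p
  ... | later _ _ m    = trans m (free⇒mate≡ L p)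

  mate≢⇒matched : ∀ L {s y} → mate L s y ≢ y → run L s ∋ y
  mate≢⇒matched L {s} {y} p with run L s y in q
  ... | true = refl
  ... | false = contradiction (free⇒mate≡ L q) p

  mate-++ : ∀ L L′ {s y} → mate L s y ≢ y → mate (L ++ L′) s y ≡ mate L s y
  mate-++ []            L′ p = contradiction refl p
  mate-++ ((u , v) ∷ L) L′ {s} {y} p with active s u v ∧ ⌊ y ≟ u ⌋ | active s u v ∧ ⌊ y ≟ v ⌋
  ... | true  | _     = refl
  ... | false | true  = refl
  ... | false | false = mate-++ L L′ p

  -- Stable matchings for a common ranking.

  Better : (Fin n → ℕ) → (Fin n → Fin n) → Fin n → Fin n → Set
  Better ρ q a b = q a ≢ a × ρ (q a) ≤ ρ b

  -- Each node prefers neighbours of smaller rank; `s` marks removed nodes, and a fixed point of `q`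
  -- is unmatched. No probing order occurs here, so runs for two permutations can be compared
  -- through their matchings alone.
  record Stable (ρ : Fin n → ℕ) (s : Status n) (q : Fin n → Fin n) : Set where
    field
      involutive : ∀ a → q (q a) ≡ a
      adjacent   : ∀ {a} → q a ≢ a → adj G a (q a) ≡ true
      blocked    : ∀ {a} → s ∋ a → q a ≡ a
      stable     : ∀ {a b} → adj G a b ≡ true → s ∌ a → s ∌ b → Better ρ q a b ⊎ Better ρ q b a

  -- Two edges compared by stability share a node, so the sum of the ranks of
  -- the endpoints serves as the induction measure in place of the
  -- lexicographic order.
  stable-⊆ : ∀ {ρ s p q} → (∀ {a b} → ρ a ≡ ρ b → a ≡ b) → Stable ρ s p → Stable ρ s q →
             ∀ a → p a ≢ a → q a ≡ p a
  stable-⊆ {ρ} {s} inj P Q a pa≢a = go P Q a (<-wellFounded _) pa≢a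
    where
    open Stable
    free : ∀ {p} → Stable ρ s p → ∀ {a} → p a ≢ a → s ∌ a
    free P {a} pa≢a with s a in e
    ... | false = refl
    ... | true = contradiction (blocked P e) pa≢a
    image-≢ : ∀ {p} → Stable ρ s p → ∀ {a} → p a ≢ a → p (p a) ≢ p a
    image-≢ P pa≢a e = pa≢a (trans (sym e) (involutive P _))
    go : ∀ {p q} → Stable ρ s p → Stable ρ s q →
         ∀ a → Acc _<_ (ρ a + ρ (p a)) → p a ≢ a → q a ≡ p a
    go {p} {q} P Q a (acc rec) pa≢a with stable Q (adjacent P pa≢a) (free P pa≢a) (free P (image-≢ P pa≢a))
    ... | inj₁ (qa≢a , le) with q a ≟ p a
    ...   | yes e = e
    -- Passing to the edge that `q` prefers lowers the rank sum; the induction hypothesis, with the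
    -- two matchings exchanged, puts this edge into `p` as well.
    ...   | no e = sym (go Q P a (rec (ℕ.+-monoʳ-< (ρ a) (ℕ.≤∧≢⇒< le (e ∘ inj)))) qa≢a)
    go {p} {q} P Q a (acc rec) pa≢a | inj₂ (qb≢b , le) with q (p a) ≟ a
    ...   | yes e = trans (cong q (sym e)) (involutive Q (p a))
    ...   | no e = contradiction
              (trans (sym (go Q P (p a) (rec (subst (ρ (p a) + ρ (q (p a)) <_) (ℕ.+-comm (ρ (p a)) (ρ a))
                 (ℕ.+-monoʳ-< (ρ (p a)) (ℕ.≤∧≢⇒< le (e ∘ inj))))) qb≢b)) (involutive P a)) e

  -- Distinct ranks make the stable matching unique. Two runs with different rankings therefore
  -- agree as soon as the matching of one is stable for the other.
  stable-unique : ∀ {ρ s p q} → (∀ {a b} → ρ a ≡ ρ b → a ≡ b) → Stable ρ s p → Stable ρ s q → p ≗ q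
  stable-unique {p = p} {q} inj P Q a with p a ≟ a | q a ≟ a
  ... | yes e | yes f = trans e (sym f)
  ... | no e  | _     = sym (stable-⊆ inj P Q a e)
  ... | yes _ | no f  = stable-⊆ inj Q P a f

  Joins : Fin n × Fin n → Fin n → Fin n → Set
  Joins (u , v) a b = (u ≡ a × v ≡ b) ⊎ (u ≡ b × v ≡ a)

  joins-sym : ∀ {e a b} → Joins e a b → Joins e b a
  joins-sym (inj₁ x) = inj₂ x
  joins-sym (inj₂ x) = inj₁ x

  -- What stability takes from the lexicographic order: of two pairs with a common node, the one
  -- whose other end has the smaller rank comes first.
  Ordered : (Fin n → ℕ) → Fin n × Fin n → Fin n × Fin n → Set
  Ordered ρ e e′ = ∀ {a b c} → Joins e a b → Joins e′ a c → ρ b ≤ ρ c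

  -- The first successful probe that touches `a` or `b` decides: the pair of `a` and `b` does not
  -- come earlier, so the order bounds the rank of the new partner. Such a probe exists, because
  -- otherwise the pair of `a` and `b` would itself succeed.
  mate-stable : ∀ {ρ} L → AllPairs (Ordered ρ) L → ∀ {s e a b} → e ∈ L → Joins e a b →
                adj G a b ≡ true → s ∌ a → s ∌ b →
                Better ρ (mate L s) a b ⊎ Better ρ (mate L s) b a
  mate-stable {ρ} ((u , v) ∷ L) (h ∷ hs) {s} {e} {a} {b} e∈ j ab sa sb
    with mateView s u v L a | mateView s u v L b
  ... | left act refl m | _ = inj₁
    ( (λ k → adj⇒≢ (edge act) (trans (sym k) m)) , ℕ.≤-trans (ℕ.≤-reflexive (cong ρ m)) (bound e∈ j) )
    where
    bound : ∀ {e} → e ∈ (u , v) ∷ L → Joins e u b → ρ v ≤ ρ b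
    bound (here refl) (inj₁ (_ , refl)) = ℕ.≤-refl
    bound (here refl) (inj₂ (refl , _)) = contradiction refl (adj⇒≢ ab)
    bound (there e∈) j = All.lookup h e∈ (inj₁ (refl , refl)) j
  ... | right act refl m | _ = inj₁
    ( (λ k → adj⇒≢ (edge act) (trans (sym m) k)) , ℕ.≤-trans (ℕ.≤-reflexive (cong ρ m)) (bound e∈ j) )
    where
    bound : ∀ {e} → e ∈ (u , v) ∷ L → Joins e v b → ρ u ≤ ρ b
    bound (here refl) (inj₁ (_ , refl)) = contradiction refl (adj⇒≢ ab)
    bound (here refl) (inj₂ (refl , _)) = ℕ.≤-refl
    bound (there e∈) j = All.lookup h e∈ (inj₂ (refl , refl)) j
  ... | later _ _ _ | left act refl m = inj₂
    ( (λ k → adj⇒≢ (edge act) (trans (sym k) m)) , ℕ.≤-trans (ℕ.≤-reflexive (cong ρ m)) (bound e∈ j) )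
    where
    bound : ∀ {e} → e ∈ (u , v) ∷ L → Joins e a u → ρ v ≤ ρ a
    bound (here refl) (inj₁ (refl , _)) = contradiction refl (adj⇒≢ ab)
    bound (here refl) (inj₂ (_ , refl)) = ℕ.≤-refl
    bound {e} (there e∈) j = All.lookup h e∈ (inj₁ (refl , refl)) (joins-sym {e} j)
  ... | later _ _ _ | right act refl m = inj₂
    ( (λ k → adj⇒≢ (edge act) (trans (sym m) k)) , ℕ.≤-trans (ℕ.≤-reflexive (cong ρ m)) (bound e∈ j) )
    where
    bound : ∀ {e} → e ∈ (u , v) ∷ L → Joins e a v → ρ u ≤ ρ a
    bound (here refl) (inj₁ (refl , _)) = ℕ.≤-refl
    bound (here refl) (inj₂ (_ , refl)) = contradiction refl (adj⇒≢ ab)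
    bound {e} (there e∈) j = All.lookup h e∈ (inj₂ (refl , refl)) (joins-sym {e} j)
  ... | later f ea ma | later g eb mb with e∈ | j
  ...   | here refl | inj₁ (refl , refl) = contradiction refl (proj₁ (f (⇒hit {s} ab sa sb)))
  ...   | here refl | inj₂ (refl , refl) =
            contradiction refl (proj₁ (g (⇒hit {s} (trans (adj-sym G u v) ab) sb sa)))
  ...   | there e∈′ | j′ with mate-stable L hs e∈′ j′ ab (trans ea sa) (trans eb sb)
  ...     | inj₁ (ne , le) = inj₁ ((λ k → ne (trans (sym ma) k)) , ℕ.≤-trans (ℕ.≤-reflexive (cong ρ ma)) le)
  ...     | inj₂ (ne , le) = inj₂ ((λ k → ne (trans (sym mb) k)) , ℕ.≤-trans (ℕ.≤-reflexive (cong ρ mb)) le)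

  -- The list of pairs probed by Ranking.

  pairs : List (Fin n) → Pairs
  pairs []       = []
  pairs (u ∷ vs) = map (u ,_) vs ++ pairs vs

  runRanking≡run : ∀ vs s → runRanking G vs s ≡ run (pairs vs) s
  runRanking≡run []       s = refl
  runRanking≡run (u ∷ vs) s = trans (runRanking≡run vs _)
    (trans (cong (run (pairs vs)) (foldl≡run vs s)) (sym (run-++ (map (u ,_) vs) (pairs vs) s)))
    where
    foldl≡run : ∀ ws s → foldl (λ s′ w → probe G s′ u w) s ws ≡ run (map (u ,_) ws) s
    foldl≡run []       s = refl
    foldl≡run (w ∷ ws) s = foldl≡run ws _

  pairs-complete : ∀ {L a b} → a ∈ L → b ∈ L → a ≢ b → ∃ λ e → e ∈ pairs L × Joins e a b
  pairs-complete (here refl) (here refl) a≢b = contradiction refl a≢b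
  pairs-complete (here refl) (there b∈) a≢b = _ , ∈-++⁺ˡ (∈-map⁺ _ b∈) , inj₁ (refl , refl)
  pairs-complete (there a∈) (here refl) a≢b = _ , ∈-++⁺ˡ (∈-map⁺ _ a∈) , inj₂ (refl , refl)
  pairs-complete {u ∷ L} (there a∈) (there b∈) a≢b with pairs-complete a∈ b∈ a≢b
  ... | e , e∈ , j = e , ∈-++⁺ʳ (map (u ,_) L) e∈ , j

  module _ {ρ : Fin n → ℕ} where

    map-ordered : ∀ {u} vs → All (λ v → ρ u < ρ v) vs → AllPairs (λ v w → ρ v < ρ w) vs →
                  AllPairs (Ordered ρ) (map (u ,_) vs)
    map-ordered []       _        _        = []
    map-ordered {u} (v ∷ vs) (uv ∷ us) (vv ∷ vs<) =
      All.map⁺ (All.zipWith ordered (us , vv)) ∷ map-ordered vs us vs<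
      where
      ordered : ∀ {w} → ρ u < ρ w × ρ v < ρ w → Ordered ρ (u , v) (u , w)
      ordered (uw , vw) (inj₁ (refl , refl)) (inj₁ (_ , refl)) = ℕ.<⇒≤ vw
      ordered (uw , vw) (inj₁ (refl , refl)) (inj₂ (_ , refl)) = contradiction uw (ℕ.<-irrefl refl)
      ordered (uw , vw) (inj₂ (refl , refl)) (inj₁ (refl , _)) = contradiction uv (ℕ.<-irrefl refl)
      ordered (uw , vw) (inj₂ (refl , refl)) (inj₂ (_ , refl)) = contradiction vw (ℕ.<-irrefl refl)

    pairs-above : ∀ {u} vs → All (λ v → ρ u < ρ v) vs →
                  All (λ { (x , y) → ρ u < ρ x × ρ u < ρ y }) (pairs vs)
    pairs-above []       _        = []
    pairs-above (v ∷ vs) (uv ∷ us) = All.++⁺ (All.map⁺ (All.map (uv ,_) us)) (pairs-above vs us)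

    -- A pair from the tail has both ends after `u`, so it can meet `(u , v)` only in `v`, and there
    -- `u` is the other end of smaller rank.
    pairs-ordered : ∀ L → AllPairs (λ v w → ρ v < ρ w) L → AllPairs (Ordered ρ) (pairs L)
    pairs-ordered []       _        = []
    pairs-ordered (u ∷ vs) (us ∷ vs<) =
      AllPairs.++⁺ (map-ordered vs us vs<) (pairs-ordered vs vs<)
        (All.map⁺ (All.map (λ uv → All.map (ordered uv) (pairs-above vs us)) us))
      where
      ordered : ∀ {v e} → ρ u < ρ v → ρ u < ρ (proj₁ e) × ρ u < ρ (proj₂ e) → Ordered ρ (u , v) e
      ordered uv (ux , uy) (inj₁ (refl , refl)) (inj₁ (refl , refl)) = contradiction ux (ℕ.<-irrefl refl)
      ordered uv (ux , uy) (inj₁ (refl , refl)) (inj₂ (refl , refl)) = contradiction uy (ℕ.<-irrefl refl)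
      ordered uv (ux , uy) (inj₂ (refl , refl)) (inj₁ (refl , refl)) = ℕ.<⇒≤ uy
      ordered uv (ux , uy) (inj₂ (refl , refl)) (inj₂ (refl , refl)) = ℕ.<⇒≤ ux

  matching-stable : ∀ {ρ L} → AllPairs (λ v w → ρ v < ρ w) L → (∀ u → u ∈ L) →
                    ∀ s → Stable ρ s (mate (pairs L) s)
  matching-stable {ρ} {L} sorted complete s = record
    { involutive = mate-invol (pairs L)
    ; adjacent   = mate-adj (pairs L)
    ; blocked    = mate-blocked (pairs L)
    ; stable     = λ {a} {b} ab sa sb →
        let e , e∈ , j = pairs-complete (complete a) (complete b) (adj⇒≢ ab)
        in mate-stable (pairs L) (pairs-ordered L sorted) e∈ j ab sa sb
    }

  -- Blocked nodes and alternating paths.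

  probe-add : ∀ s u v {x} → probe G s u v ∌ x → probe G (add s x) u v ≗ add (probe G s u v) x
  probe-add s u v {x} s′x w with probeView s u v | probeView (add s x) u v
  ... | miss _ _ e | miss _ _ f = trans (f w) (cong (⌊ w ≟ x ⌋ ∨_) (sym (e w)))
  ... | miss _ m _ | hit _ uv xu xv _ _ _ = true≢false refl (m uv (free xu) (free xv))
    where
    free : ∀ {z} → add s x ∌ z → s ∌ z
    free {z} p with z ≟ x
    ... | yes _ = true≢false refl p
    ... | no _ = p
  ... | hit _ uv su sv s′u s′v e | miss _ m _ = true≢false refl
    (m uv (trans (add-other s u≢x) su) (trans (add-other s v≢x) sv))
    where
    u≢x : u ≢ x
    u≢x refl = true≢false s′u s′x
    v≢x : v ≢ x
    v≢x refl = true≢false s′v s′x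
  ... | hit _ _ _ _ s′u s′v e | hit _ _ _ _ xu xv f with w ≟ u | w ≟ v
  ...   | yes refl | _ = trans xu (sym (trans (add-other (probe G s u v) (λ { refl → true≢false s′u s′x })) s′u))
  ...   | no _ | yes refl = trans xv (sym (trans (add-other (probe G s u v) (λ { refl → true≢false s′v s′x })) s′v))
  ...   | no w≢u | no w≢v = trans (f w w≢u w≢v) (cong (⌊ w ≟ x ⌋ ∨_) (sym (e w w≢u w≢v)))

  joins-adj : ∀ {u v a b} → Joins (u , v) a b → adj G u v ≡ true → adj G a b ≡ true
  joins-adj (inj₁ (refl , refl)) p = p
  joins-adj {u} {v} (inj₂ (refl , refl)) p = trans (adj-sym G v u) p

  joins-free : ∀ {s u v a b} → Joins (u , v) a b → s ∌ u → s ∌ v → s ∌ a × s ∌ b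
  joins-free (inj₁ (refl , refl)) p q = p , q
  joins-free (inj₂ (refl , refl)) p q = q , p

  free-joins : ∀ {s u v a b} → Joins (u , v) a b → s ∌ a → s ∌ b → s ∌ u × s ∌ v
  free-joins (inj₁ (refl , refl)) p q = p , q
  free-joins (inj₂ (refl , refl)) p q = q , p

  -- Blocking `x` stops this probe, so the left side is `add s x`. The filled node `y` must be the
  -- one node in which `probe G s u v` differs from `t`, and freeing `y` in that state also leaves
  -- `add s x`.
  block-partner : ∀ {s t u v x y} → Hit s u v → Joins (u , v) x y →
                  Diff (probe G s u v) t → t ∌ y → probe G (add s x) u v ≗ t
  block-partner {s} {t} {u} {v} {x} {y} act j δ ty w with probeView s u v | probeView (add s x) u v
  ... | miss b _ _ | _ = true≢false (isActive act) b
  ... | hit _ _ su sv s′u s′v e | hit _ _ xu xv _ _ _ =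
    true≢false (add-self s x) (proj₁ (joins-free {add s x} j xu xv))
  ... | hit _ uv su sv s′u s′v e | miss _ _ f = trans (f w) (agree j)
    where
    sxy = joins-free {s} j su sv
    -- Applied to the complement of the state, `joins-free` shows that `x` and `y` are both matched
    -- by the probe.
    s′xy = joins-free {not ∘ probe G s u v} j (cong not s′u) (cong not s′v)
    same = proj₂ (diff-unique {e = y} δ (trans (not-injective {y = true} (proj₂ s′xy)) (cong not (sym ty))))
    agree : Joins (u , v) x y → add s x w ≡ t w
    agree j with w ≟ y
    ... | yes refl = trans (add-other s (λ { refl → adj⇒≢ (joins-adj j uv) refl })) (trans (proj₂ sxy) (sym ty))
    ... | no w≢y with w ≟ x
    ...   | yes refl = trans (sym (not-injective {y = true} (proj₁ s′xy))) (same w w≢y)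
    ...   | no w≢x = trans (sym (e w (≢u j) (≢v j))) (same w w≢y)
      where
      ≢u : Joins (u , v) x y → w ≢ u
      ≢u (inj₁ (refl , _)) = w≢x
      ≢u (inj₂ (refl , _)) = w≢y
      ≢v : Joins (u , v) x y → w ≢ v
      ≢v (inj₁ (_ , refl)) = w≢y
      ≢v (inj₂ (_ , refl)) = w≢x

  -- From the moment y is matched to x in the run from s until y is matched in
  -- the run from t, the state of the latter is that of the former with y free;
  -- but so is the state of the run from s in which x is blocked.
  run-blocking-mate : ∀ L {s t y} → Diff s t → s ∌ y → run L s ∋ y → run L t ∌ y →
                      run L (add s (mate L s y)) ≗ run L t
  run-blocking-mate []            _ sy p _ = true≢false p sy
  run-blocking-mate ((u , v) ∷ L) {s} {t} {y} δ sy p q with mateView s u v L y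
  ... | left act refl m = run-cong L (λ w → trans (cong (λ x → probe G (add s x) u v w) m)
      (block-partner act (inj₂ (refl , refl)) (diff-probe δ u v) (run-free L _ q) w))
  ... | right act refl m = run-cong L (λ w → trans (cong (λ x → probe G (add s x) u v w) m)
      (block-partner act (inj₁ (refl , refl)) (diff-probe δ u v) (run-free L _ q) w))
  ... | later f e m = λ w → trans (cong (λ x → run L (probe G (add s x) u v) w) m)
      (trans (run-cong L (probe-add s u v (mate-free L (matched⇒mate≢ L (trans e sy) p))) w)
             (run-blocking-mate L (diff-probe δ u v) (trans e sy) p q w))

  first-match : ∀ L {t e} → t ∌ e → run L t ∋ e →
                ∃₂ λ L₁ L₂ → ∃₂ λ u v → L ≡ L₁ ++ (u , v) ∷ L₂ × (∃ λ y → Joins (u , v) y e) ×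
                Hit (run L₁ t) u v
  first-match []            te p = true≢false p te
  first-match ((u , v) ∷ L) {t} {e} te p with mateView t u v L e
  ... | left act refl _  = [] , L , u , v , refl , (v , inj₂ (refl , refl)) , act
  ... | right act refl _ = [] , L , u , v , refl , (u , inj₁ (refl , refl)) , act
  ... | later _ eq _ with first-match L (trans eq te) p
  ...   | L₁ , L₂ , u′ , v′ , refl , j , act = (u , v) ∷ L₁ , L₂ , u′ , v′ , refl , j , act

  -- The node y is the last but one on the alternating path from t to e.
  alternating-end : ∀ L {s t e} → (∀ w → s ∌ w) → Diff s t → run L s ∌ e → t ∌ e → run L t ∋ e →
                    ∃ λ y → run L s ∋ y × t ∌ y × adj G y e ≡ true ×
                    run L (add s (mate L s y)) ≗ run L t
  alternating-end L {s} {t} {e} s∅ δ se te te′ with first-match L te te′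
  ... | L₁ , L₂ , u , v , refl , (y , j) , act = y , sy , run-free L₁ t ty , yadj , eq
    where
    ty×te = joins-free {run L₁ t} j (free₁ act) (free₂ act)
    ty = proj₁ ty×te
    yadj = joins-adj j (edge act)
    M = L₁ ++ (u , v) ∷ L₂
    split : ∀ r → run M r ≡ run L₂ (probe G (run L₁ r) u v)
    split r = run-++ L₁ _ r
    later-free : probe G (run L₁ s) u v ∌ e
    later-free = run-free L₂ _ (trans (cong-app (sym (split s)) e) se)
    -- In the run from `s` the node `e` stays free although its pair with `y` is probed; hence `y`
    -- was matched earlier.
    s₁y : run L₁ s ∋ y
    s₁y with run L₁ s y in r
    ... | true = refl
    ... | false with free-joins {run L₁ s} j r (probe-free (run L₁ s) u v later-free)
    ...   | su , sv with joins-free {not ∘ probe G (run L₁ s) u v} j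
                    (cong not (filled₁ (⇒hit {run L₁ s} (edge act) su sv)))
                    (cong not (filled₂ (⇒hit {run L₁ s} (edge act) su sv)))
    ...     | _ , k = true≢false (not-injective {y = true} k) later-free
    sy : run M s ∋ y
    sy = trans (cong-app (split s) y) (run-mono L₂ _ (probe-mono _ u v s₁y))
    -- In the run from `t` the node `y` is free until its pair with `e` is probed, so
    -- `run-blocking-mate` applies to `L₁`; equal states stay equal on the rest of the list.
    eq : run M (add s (mate M s y)) ≗ run M t
    eq w = begin
      run M (add s (mate M s y)) w                          ≡⟨ cong (λ x → run M (add s x) w) (mate-++ L₁ _ (matched⇒mate≢ L₁ (s∅ y) s₁y)) ⟩
      run M (add s (mate L₁ s y)) w                         ≡⟨ cong-app (split _) w ⟩
      run L₂ (probe G (run L₁ (add s (mate L₁ s y))) u v) w ≡⟨ run-cong ((u , v) ∷ L₂) (run-blocking-mate L₁ δ (s∅ y) s₁y ty) w ⟩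
      run L₂ (probe G (run L₁ t) u v) w                     ≡⟨ cong-app (split t) w ⟨
      run M t w                                             ∎
      where open ≡-Reasoning

-- The enumeration of permutations and its invariance under relabelling of ranks.

Injective : ∀ {n} → Vec (Fin n) n → Set
Injective σ = ∀ {u v} → lookup σ u ≡ lookup σ v → u ≡ v

isInjective⇒ : ∀ {n} (σ : Vec (Fin n) n) → T (isInjective σ) → Injective σ
isInjective⇒ {n} σ p {u} {v} e with All.lookup (All.all⁺ _ (allFin n) (All.lookup (All.all⁺ _ (allFin n) p) (∈-allFin u))) (∈-allFin v)
... | q with u ≟ v | lookup σ u ≟ lookup σ v
...   | yes u≡v | _    = u≡v
...   | no _    | no f = contradiction e f

⇒isInjective : ∀ {n} (σ : Vec (Fin n) n) → Injective σ → T (isInjective σ)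
⇒isInjective {n} σ inj = All.all⁻ _ (All.universal (λ u → All.all⁻ _ (All.universal (distinct u) (allFin n))) (allFin n))
  where
  distinct : ∀ u v → T (⌊ u ≟ v ⌋ ∨ not ⌊ lookup σ u ≟ lookup σ v ⌋)
  distinct u v with u ≟ v | lookup σ u ≟ lookup σ v
  ... | yes _  | _     = _
  ... | no _   | no _  = _
  ... | no u≢v | yes e = u≢v (inj e)

∈-allVecs : ∀ {k m} (σ : Vec (Fin m) k) → σ ∈ allVecs k m
∈-allVecs Vec.[]      = here refl
∈-allVecs (i Vec.∷ σ) = ∈-concatMap⁺ _ (lose (∈-allFin i) (∈-map⁺ _ (∈-allVecs σ)))

allVecs-unique : ∀ k m → Unique (allVecs k m)
allVecs-unique zero    m = [] ∷ []
allVecs-unique (suc k) m = Unique.concat⁺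
  (All.map⁺ (All.universal (λ i → Unique.map⁺ Vec.∷-injectiveʳ (allVecs-unique k m)) (allFin m)))
  (AllPairs.map⁺ (AllPairs.tabulate⁺ disjoint))
  where
  disjoint : ∀ {i j} → i ≢ j → ∀ {σ} →
             σ ∈ map (i Vec.∷_) (allVecs k m) × σ ∈ map (j Vec.∷_) (allVecs k m) → _
  disjoint i≢j (p , q) with ∈-map⁻ _ p | ∈-map⁻ _ q
  ... | _ , _ , refl | _ , _ , e = i≢j (Vec.∷-injectiveˡ e)

∈-permutations⁺ : ∀ {n} {σ : Vec (Fin n) n} → Injective σ → σ ∈ permutations n
∈-permutations⁺ {σ = σ} inj = ∈-filter⁺ (λ τ → T? (isInjective τ)) (∈-allVecs σ) (⇒isInjective σ inj)

∈-permutations⁻ : ∀ {n} {σ : Vec (Fin n) n} → σ ∈ permutations n → Injective σ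
∈-permutations⁻ {n} {σ} σ∈ =
  isInjective⇒ σ (proj₂ (∈-filter⁻ (λ τ → T? (isInjective τ)) {xs = allVecs n n} σ∈))

permutations-unique : ∀ n → Unique (permutations n)
permutations-unique n = Unique.filter⁺ (λ τ → T? (isInjective τ)) (allVecs-unique n n)

module _ {n} (π : Permutation n n) where

  relabel : Vec (Fin n) n → Vec (Fin n) n
  relabel = Vec.map (π ⟨$⟩ʳ_)

  ⟨$⟩ʳ-injective : ∀ {i j} → π ⟨$⟩ʳ i ≡ π ⟨$⟩ʳ j → i ≡ j
  ⟨$⟩ʳ-injective e = trans (sym (Perm.inverseˡ π)) (trans (cong (π ⟨$⟩ˡ_) e) (Perm.inverseˡ π))

  relabel-injective : ∀ {σ} → Injective σ → Injective (relabel σ)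
  relabel-injective {σ} inj {u} {v} e = inj (⟨$⟩ʳ-injective
    (trans (sym (Vec.lookup-map u (π ⟨$⟩ʳ_) σ)) (trans e (Vec.lookup-map v (π ⟨$⟩ʳ_) σ))))

module _ {n} (π : Permutation n n) where

  relabel-flip : ∀ σ → relabel π (relabel (Perm.flip π) σ) ≡ σ
  relabel-flip σ = trans (sym (Vec.map-∘ (π ⟨$⟩ʳ_) (π ⟨$⟩ˡ_) σ))
    (trans (Vec.map-cong (λ _ → Perm.inverseʳ π) σ) (Vec.map-id σ))

  relabel-cancel : ∀ {σ τ} → relabel π σ ≡ relabel π τ → σ ≡ τ
  relabel-cancel {σ} {τ} e = trans (sym (back σ)) (trans (cong (relabel (Perm.flip π)) e) (back τ))
    where
    back : ∀ σ → relabel (Perm.flip π) (relabel π σ) ≡ σ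
    back σ = trans (sym (Vec.map-∘ (π ⟨$⟩ˡ_) (π ⟨$⟩ʳ_) σ))
      (trans (Vec.map-cong (λ _ → Perm.inverseˡ π) σ) (Vec.map-id σ))

  permutations-↭ : permutations n ↭ map (relabel π) (permutations n)
  permutations-↭ = ∼bag⇒↭ (unique∧set⇒bag (permutations-unique n)
    (Unique.map⁺ relabel-cancel (permutations-unique n)) (mk⇔ to from))
    where
    to : ∀ {σ} → σ ∈ permutations n → σ ∈ map (relabel π) (permutations n)
    to {σ} σ∈ = subst (_∈ map (relabel π) (permutations n)) (relabel-flip σ)
      (∈-map⁺ (relabel π) (∈-permutations⁺ (relabel-injective (Perm.flip π) {σ} (∈-permutations⁻ σ∈))))
    from : ∀ {σ} → σ ∈ map (relabel π) (permutations n) → σ ∈ permutations n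
    from σ∈ with ∈-map⁻ (relabel π) σ∈
    ... | τ , τ∈ , refl = ∈-permutations⁺ (relabel-injective π {τ} (∈-permutations⁻ τ∈))

  -- Invariance of the uniform distribution under a bijection of the ranks.
  sum-relabel : ∀ f → sum (map (f ∘ relabel π) (permutations n)) ≡ sum (map f (permutations n))
  sum-relabel f = trans (cong sum (map-∘ (permutations n)))
    (sym (sum-↭ (↭.map⁺ f permutations-↭)))

-- Nodes in the order of their ranks.

rank : ∀ {n} → Vec (Fin n) n → Fin n → ℕ
rank σ u = toℕ (lookup σ u)

rank-injective : ∀ {n} {σ : Vec (Fin n) n} → Injective σ → ∀ {a b} → rank σ a ≡ rank σ b → a ≡ b
rank-injective inj = inj ∘ Fin.toℕ-injective

allPairs-within : ∀ {A : Set} {P : A → Set} {R : A → A → Set} {xs} →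
                  (∀ {x y} → P x → P y → x ≢ y → R x y) → All P xs → Unique xs → AllPairs R xs
allPairs-within f []        []       = []
allPairs-within f (px ∷ ps) (x∉ ∷ u) =
  All.zipWith (λ (py , x≢y) → f px py x≢y) (ps , x∉) ∷ allPairs-within f ps u

module _ {n} {σ : Vec (Fin n) n} where

  private
    ranked : Fin n → List (Fin n)
    ranked r = filter (λ u → lookup σ u ≟ r) (allFin n)

    ranked-rank : ∀ r → All (λ u → lookup σ u ≡ r) (ranked r)
    ranked-rank r = All.all-filter (λ u → lookup σ u ≟ r) (allFin n)

  byRank-sorted : Injective σ → AllPairs (λ u v → rank σ u < rank σ v) (byRank σ)
  byRank-sorted inj = AllPairs.concat⁺
    (All.map⁺ (All.universal (λ r → allPairs-within
       -- Two nodes of equal rank coincide, so a block of `byRank` has at most one element.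
       (λ p q u≢v → contradiction (inj (trans p (sym q))) u≢v) (ranked-rank r)
       (Unique.filter⁺ (λ u → lookup σ u ≟ r) (Unique.allFin⁺ n))) (allFin n)))
    (AllPairs.map⁺ (AllPairs.tabulate⁺-< λ {i} {j} i<j →
       All.map (λ p → All.map (λ q → subst₂ (λ x y → toℕ x < toℕ y) (sym p) (sym q) i<j)
         (ranked-rank j)) (ranked-rank i)))

  byRank-complete : ∀ u → u ∈ byRank σ
  byRank-complete u = ∈-concatMap⁺ ranked
    (lose (∈-allFin (lookup σ u)) (∈-filter⁺ (λ w → lookup σ w ≟ lookup σ u) (∈-allFin u) refl))

-- Moving a single rank.

punchIn-below : ∀ {n} (i : Fin (suc n)) k → toℕ k < toℕ i → toℕ (punchIn i k) ≡ toℕ k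
punchIn-below (Fin.suc i) Fin.zero    _       = refl
punchIn-below (Fin.suc i) (Fin.suc k) (s≤s p) = cong suc (punchIn-below i k p)

punchIn-below⁻ : ∀ {n} (i : Fin (suc n)) k → toℕ (punchIn i k) < toℕ i → toℕ k < toℕ i
punchIn-below⁻ (Fin.suc i) Fin.zero    _       = s≤s z≤n
punchIn-below⁻ (Fin.suc i) (Fin.suc k) (s≤s p) = s≤s (punchIn-below⁻ i k p)

module _ {n} (i j : Fin (suc n)) where

  -- The cyclic shift that takes rank `i` to rank `j` and keeps all other ranks in their relative
  -- order.
  shift : Permutation (suc n) (suc n)
  shift = Perm.insert i j Perm.id

  shift-self : shift ⟨$⟩ʳ i ≡ j
  shift-self with i ≟ i
  ... | yes _ = refl
  ... | no i≢i = contradiction refl i≢i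

  shift-punchIn : ∀ {k} → k ≢ i → ∃ λ k′ → k ≡ punchIn i k′ × shift ⟨$⟩ʳ k ≡ punchIn j k′
  shift-punchIn {k} k≢i = k′ , sym eq , trans (cong (shift ⟨$⟩ʳ_) (sym eq)) (Perm.insert-punchIn i j Perm.id k′)
    where
    k′ = punchOut (k≢i ∘ sym)
    eq = Fin.punchIn-punchOut (k≢i ∘ sym)

  shift-cancel-≤ : ∀ {k l} → k ≢ i → l ≢ i → toℕ (shift ⟨$⟩ʳ k) ≤ toℕ (shift ⟨$⟩ʳ l) → toℕ k ≤ toℕ l
  shift-cancel-≤ k≢i l≢i p with shift-punchIn k≢i | shift-punchIn l≢i
  ... | k′ , refl , e | l′ , refl , f =
    Fin.punchIn-mono-≤ i k′ l′ (Fin.punchIn-cancel-≤ j k′ l′ (subst₂ (λ x y → toℕ x ≤ toℕ y) e f p))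

  shift-below : toℕ j ≤ toℕ i → ∀ {k} → k ≢ i → toℕ (shift ⟨$⟩ʳ k) < toℕ j → toℕ k < toℕ j
  shift-below j≤i k≢i p with shift-punchIn k≢i
  ... | k′ , refl , e = subst (_< toℕ j) (sym (punchIn-below i k′ (ℕ.<-≤-trans k′<j j≤i))) k′<j
    where k′<j = punchIn-below⁻ j k′ (subst (λ x → toℕ x < toℕ j) e p)

-- The argument is the old rank `i` and not a node, so that one fixed bijection acts on all
-- permutations and `sum-relabel` applies. A node `u` is moved by taking `lookup σ u` for `i`.
move : ∀ {n} → Fin (suc n) → Fin (suc n) → Vec (Fin (suc n)) (suc n) → Vec (Fin (suc n)) (suc n)
move i j = relabel (shift i j)

-- The effect on Ranking of moving one node.

module Ranking {m : ℕ} (G : Graph (suc m)) where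
  private n = suc m
  open Greedy G public

  edges : Vec (Fin n) n → Pairs
  edges σ = pairs (byRank σ)

  matched : Vec (Fin n) n → Fin n → Bool
  matched σ = run (edges σ) ∅

  partner : Vec (Fin n) n → Fin n → Fin n
  partner σ = mate (edges σ) ∅

  partner-stable : ∀ {σ} → Injective σ → ∀ s → Stable (rank σ) s (mate (edges σ) s)
  partner-stable {σ} inj = matching-stable (byRank-sorted {σ = σ} inj) (byRank-complete {σ = σ})


  module _ {ρ ρ′ : Fin n → ℕ} {q u} (S : Stable ρ′ ∅ q) (qu : q u ≡ u)
           (keep : ∀ {a b} → a ≢ u → b ≢ u → ρ′ a ≤ ρ′ b → ρ a ≤ ρ b) where
    open Stable S

    private
      mate≢u : ∀ {a} → q a ≢ a → q a ≢ u
      mate≢u {a} qa≢a e = qa≢a (trans e (sym (trans (sym (involutive a)) (trans (cong q e) qu))))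

      better : ∀ {a b} → b ≢ u → Better ρ′ q a b → Better ρ q a b
      better b≢u (qa≢a , le) = qa≢a , keep (mate≢u qa≢a) b≢u le

    -- The free node `u` enters stability only as an alternative to some partner, and by `top` the
    -- partners preferred to `u` under `ρ′` are still preferred to it under `ρ`.
    stable-demote : (∀ {a} → a ≢ u → ρ′ a ≤ ρ′ u → ρ a ≤ ρ u) → Stable ρ ∅ q
    stable-demote top = record
      { involutive = involutive
      ; adjacent   = adjacent
      ; blocked    = λ ()
      ; stable     = λ ab sa sb → Sum.map better′ better′ (stable ab sa sb)
      }
      where
      better′ : ∀ {a b} → Better ρ′ q a b → Better ρ q a b
      better′ {b = b} (qa≢a , le) with b ≟ u
      ... | yes refl = qa≢a , top (mate≢u qa≢a) le
      ... | no b≢u = better b≢u (qa≢a , le)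

    stable-isolate : Stable ρ (add ∅ u) q
    stable-isolate = record
      { involutive = involutive
      ; adjacent   = adjacent
      ; blocked    = blocked′
      ; stable     = λ ab sa sb → Sum.map (better (≢u sb)) (better (≢u sa)) (stable ab refl refl)
      }
      where
      ≢u : ∀ {a} → add ∅ u ∌ a → a ≢ u
      ≢u p refl = true≢false (add-self ∅ u) p
      blocked′ : ∀ {a} → add ∅ u ∋ a → q a ≡ a
      blocked′ {a} p with a ≟ u
      ... | yes refl = qu
      blocked′ {a} () | no _

  module _ {σ : Vec (Fin n) n} (inj : Injective σ) (u : Fin n) (j : Fin n) where

    private
      i  = lookup σ u
      σ′ = move i j σ

    move-injective : Injective σ′
    move-injective = relabel-injective (shift i j) {σ} inj

    rank-move : ∀ a → rank σ′ a ≡ toℕ (shift i j ⟨$⟩ʳ lookup σ a)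
    rank-move a = cong toℕ (Vec.lookup-map a (shift i j ⟨$⟩ʳ_) σ)

    rank-move-self : lookup σ′ u ≡ j
    rank-move-self = trans (Vec.lookup-map u (shift i j ⟨$⟩ʳ_) σ) (shift-self i j)

    rank-move-cancel-≤ : ∀ {a b} → a ≢ u → b ≢ u → rank σ′ a ≤ rank σ′ b → rank σ a ≤ rank σ b
    rank-move-cancel-≤ {a} {b} a≢u b≢u le =
      shift-cancel-≤ i j (a≢u ∘ inj) (b≢u ∘ inj) (subst₂ _≤_ (rank-move a) (rank-move b) le)

    rank-move-below : toℕ j ≤ toℕ i → ∀ {a} → a ≢ u → rank σ′ a ≤ toℕ j → rank σ a < toℕ j
    rank-move-below j≤i {a} a≢u le = shift-below i j j≤i (a≢u ∘ inj)
      (subst (_< toℕ j) (rank-move a) (ℕ.≤∧≢⇒< le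
        (λ e → a≢u (move-injective (Fin.toℕ-injective (trans e (cong toℕ (sym rank-move-self))))))))

    -- Uniqueness of the stable matching: a free node can be deleted, and without `u` the orders of
    -- `σ` and `σ′` coincide.
    partner-isolate : partner σ′ u ≡ u → mate (edges σ) (add ∅ u) ≗ partner σ′
    partner-isolate free = stable-unique (rank-injective {σ = σ} inj) (partner-stable {σ} inj (add ∅ u))
      (stable-isolate (partner-stable {σ′} move-injective ∅) free rank-move-cancel-≤)

    -- Here `σ` is the permutation with `u` at the later rank; nodes that precede `u` at rank `j`
    -- also precede it at rank `i`.
    partner-demote : toℕ j ≤ toℕ i → partner σ′ u ≡ u → partner σ ≗ partner σ′
    partner-demote j≤i free = stable-unique (rank-injective {σ = σ} inj) (partner-stable {σ} inj ∅)
      (stable-demote (partner-stable {σ′} move-injective ∅) free rank-move-cancel-≤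
        (λ {a} a≢u le → ℕ.<⇒≤ (ℕ.<-≤-trans
          (rank-move-below j≤i a≢u (subst (rank σ′ a ≤_) (cong toℕ rank-move-self) le)) j≤i)))

    matched-promote : toℕ j ≤ toℕ i → matched σ ∋ u → matched σ′ ∋ u
    matched-promote j≤i p with matched σ′ u in e
    ... | true = refl
    ... | false = contradiction (trans (partner-demote j≤i (free⇒mate≡ (edges σ′) e) u) (free⇒mate≡ (edges σ′) e))
                    (matched⇒mate≢ (edges σ) refl p)

    -- As `σ′` leaves `u` free, maximality matches all its neighbours there, and `partner-isolate`
    -- carries this over to the run without `u`.
    isolate-saturated : matched σ′ ∌ u → ∀ {w} → adj G u w ≡ true → run (edges σ) (add ∅ u) ∋ w
    isolate-saturated free {w} uw with run (edges σ) (add ∅ u) w in e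
    ... | true = refl
    ... | false with Stable.stable (partner-stable {σ′} move-injective ∅) {u} {w} uw refl refl
    ...   | inj₁ (pu≢u , _) = contradiction (free⇒mate≡ (edges σ′) free) pu≢u
    ...   | inj₂ (pw≢w , _) = contradiction
              (trans (sym (partner-isolate (free⇒mate≡ (edges σ′) free) w)) (free⇒mate≡ (edges σ) e)) pw≢w

    -- With `u` free, stability leaves only the case that `w` has a partner at least as good as `u`.
    -- This partner is not `u`, hence the strict inequality.
    partner-before : matched σ ∌ u → ∀ {w} → adj G u w ≡ true →
                     partner σ w ≢ w × rank σ (partner σ w) < rank σ u
    partner-before free {w} uw with Stable.stable (partner-stable {σ} inj ∅) {u} {w} uw refl refl
    ... | inj₁ (pu≢u , _) = contradiction (free⇒mate≡ (edges σ) free) pu≢u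
    ... | inj₂ (pw≢w , le) = pw≢w , ℕ.≤∧≢⇒< le (pw≢u ∘ rank-injective {σ = σ} inj)
      where
      pw≢u : partner σ w ≢ u
      pw≢u e = adj⇒≢ uw (trans (sym (free⇒mate≡ (edges σ) free))
        (trans (cong (partner σ) (sym e)) (mate-invol (edges σ) w)))

  -- In the second case `partner-before` applies to the permutation with `u` at rank `t`. Putting
  -- the free node `u` back to its later rank keeps the matching, and the partner of `w`, being
  -- different from `u`, keeps a rank below `t`.
  partner-early : ∀ {σ} → Injective σ → ∀ {u w} t → adj G u w ≡ true →
    (rank σ u < toℕ t × matched σ ∌ u) ⊎ (toℕ t ≤ rank σ u × matched (move (lookup σ u) t σ) ∌ u) →
    matched σ ∋ partner σ w × rank σ (partner σ w) < toℕ t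
  partner-early {σ} inj {u} {w} t uw (inj₁ (lt , free)) with partner-before {σ} inj u t free uw
  ... | pw≢w , lt′ = mate≢⇒matched (edges σ) (λ e → pw≢w (trans (sym e) (mate-invol (edges σ) w))) , ℕ.<-trans lt′ lt
  partner-early {σ} inj {u} {w} t uw (inj₂ (t≤ , free))
    with partner-before {move (lookup σ u) t σ} (move-injective {σ} inj u t) u t free uw
       | partner-demote {σ} inj u t t≤ (free⇒mate≡ (edges (move (lookup σ u) t σ)) free)
  ... | pw≢w , lt | same = mate≢⇒matched (edges σ)
          (λ e → pw≢w (trans (sym (same w)) (trans (sym e) (mate-invol (edges σ) w))))
        , rank-move-below {σ} inj u t t≤ ≢u (ℕ.<⇒≤ lt″)
    where
    σ′ = move (lookup σ u) t σ
    lt″ : rank σ′ (partner σ w) < toℕ t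
    lt″ = subst₂ _<_ (cong (rank σ′) (sym (same w))) (cong toℕ (rank-move-self {σ} inj u t)) lt
    ≢u : partner σ w ≢ u
    ≢u refl = ℕ.<-irrefl (cong toℕ (rank-move-self {σ} inj u t)) lt″

-- Finite sums and counting.

⟦_⟧ : Bool → ℕ
⟦ b ⟧ = if b then 1 else 0

Σ-mono : ∀ {n} {f g : Fin n → ℕ} → (∀ i → f i ≤ g i) → Σ f ≤ Σ g
Σ-mono {zero}  h = z≤n
Σ-mono {suc n} h = ℕ.+-mono-≤ (h Fin.zero) (Σ-mono (h ∘ Fin.suc))

Σ-zero : ∀ {n} {f : Fin n → ℕ} → (∀ i → f i ≡ 0) → Σ f ≡ 0
Σ-zero {zero}  h = refl
Σ-zero {suc n} h = cong₂ _+_ (h Fin.zero) (Σ-zero (h ∘ Fin.suc))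

Σ-select : ∀ {n} (g : Fin n → ℕ) i → Σ (λ j → ⟦ does (i ≟ j) ⟧ * g j) ≡ g i
Σ-select {suc n} g Fin.zero = trans (cong₂ _+_ (ℕ.*-identityˡ (g Fin.zero)) (Σ-zero {n} (λ _ → refl))) (ℕ.+-identityʳ _)
Σ-select {suc n} g (Fin.suc i) = Σ-select (g ∘ Fin.suc) i

Σ-involution : ∀ {n} (g : Fin n → ℕ) (f : Fin n → Fin n) → (∀ i → f (f i) ≡ i) → Σ (g ∘ f) ≡ Σ g
Σ-involution g f inv = sym (sum-permute g (permutation f f inv inv))

Σ-fibres : ∀ {m n} (f : Fin m → Fin n) (h : Fin n → Fin m → ℕ) →
           Σ (λ u → h (f u) u) ≡ Σ (λ j → Σ (λ u → ⟦ does (f u ≟ j) ⟧ * h j u))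
Σ-fibres f h = trans (sum-cong-≗ (λ u → sym (Σ-select (λ j → h j u) (f u))))
  (∑-comm (λ u j → ⟦ does (f u ≟ j) ⟧ * h j u))

-- Summing over fibres: the fibre of `f` over `v` contains at most one element of `A`, and none
-- unless `v` lies in `B`.
Σ-map : ∀ {n} {A B : Fin n → Bool} (f : Fin n → Fin n) → (∀ {u} → A ∋ u → B ∋ f u) →
        (∀ {u v} → A ∋ u → A ∋ v → f u ≡ f v → u ≡ v) → Σ (⟦_⟧ ∘ A) ≤ Σ (⟦_⟧ ∘ B)
Σ-map {n} {A} {B} f into inj = ℕ.≤-trans (ℕ.≤-reflexive (Σ-fibres f (λ _ → ⟦_⟧ ∘ A))) (Σ-mono fibre)
  where
  fibre : ∀ v → Σ (λ u → ⟦ does (f u ≟ v) ⟧ * ⟦ A u ⟧) ≤ ⟦ B v ⟧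
  fibre v with Fin.any? (λ u → (A u Bool.≟ true) ×-dec (f u ≟ v))
  ... | no none = ℕ.≤-trans (ℕ.≤-reflexive (Σ-zero vanish)) z≤n
    where
    vanish : ∀ u → ⟦ does (f u ≟ v) ⟧ * ⟦ A u ⟧ ≡ 0
    vanish u with f u ≟ v | A u in e
    ... | no _   | _     = refl
    ... | yes _  | false = refl
    ... | yes fu | true  = contradiction (u , e , fu) none
  ... | yes (u₀ , Au₀ , refl) = ℕ.≤-trans (Σ-mono only) (ℕ.≤-reflexive
          (trans (Σ-select (λ _ → 1) u₀) (cong ⟦_⟧ (sym (into Au₀)))))
    where
    only : ∀ u → ⟦ does (f u ≟ f u₀) ⟧ * ⟦ A u ⟧ ≤ ⟦ does (u₀ ≟ u) ⟧ * 1
    only u with f u ≟ f u₀ | A u in e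
    ... | no _   | _     = z≤n
    ... | yes _  | false = z≤n
    ... | yes fu | true with u₀ ≟ u
    ...   | yes _ = ℕ.≤-refl
    ...   | no u₀≢u = contradiction (inj Au₀ e (sym fu)) u₀≢u

Σ-injection : ∀ {n} {A B : Fin n → Bool} (R : Fin n → Fin n → Set) →
              (∀ {u} → A ∋ u → ∃ λ v → B ∋ v × R u v) → (∀ {u u′ v} → R u v → R u′ v → u ≡ u′) →
              Σ (⟦_⟧ ∘ A) ≤ Σ (⟦_⟧ ∘ B)
Σ-injection {n} {A} {B} R total inj = Σ-map (proj₁ ∘ image) (λ {u} → proj₁ ∘ proj₂ (image u))
  (λ {u} {v} Au Av e → inj (proj₂ (proj₂ (image u) Au)) (subst (R v) (sym e) (proj₂ (proj₂ (image v) Av))))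
  where
  image : ∀ u → ∃ λ v → A ∋ u → B ∋ v × R u v
  image u with A u in e
  ... | true = proj₁ (total e) , λ _ → proj₂ (total e)
  -- A default value: outside `A` nothing is required of the image.
  ... | false = u , λ ()

module _ {A : Set} where

  sum-mono : ∀ {f g : A → ℕ} xs → (∀ {x} → x ∈ xs → f x ≤ g x) → sum (map f xs) ≤ sum (map g xs)
  sum-mono []       h = z≤n
  sum-mono (x ∷ xs) h = ℕ.+-mono-≤ (h (here refl)) (sum-mono xs (h ∘ there))

  sum-const : ∀ c (xs : List A) → sum (map (λ _ → c) xs) ≡ length xs * c
  sum-const c []       = refl
  sum-const c (x ∷ xs) = cong (c +_) (sum-const c xs)

  sum-+ : ∀ (f g : A → ℕ) xs → sum (map (λ x → f x + g x) xs) ≡ sum (map f xs) + sum (map g xs)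
  sum-+ f g []       = refl
  sum-+ f g (x ∷ xs) rewrite sum-+ f g xs = solve-∀′ (f x) (g x) _ _
    where
    solve-∀′ : ∀ a b c d → a + b + (c + d) ≡ a + c + (b + d)
    solve-∀′ = solve-∀

  sum-* : ∀ c (f : A → ℕ) xs → sum (map (λ x → c * f x) xs) ≡ c * sum (map f xs)
  sum-* c f []       = sym (ℕ.*-zeroʳ c)
  sum-* c f (x ∷ xs) = trans (cong (c * f x +_) (sum-* c f xs)) (sym (ℕ.*-distribˡ-+ c (f x) _))

  sum-Σ : ∀ {n} (f : A → Fin n → ℕ) xs → sum (map (λ x → Σ (f x)) xs) ≡ Σ (λ i → sum (map (λ x → f x i) xs))
  sum-Σ {n} f []   = sym (Σ-zero {n} (λ _ → refl))
  sum-Σ f (x ∷ xs) = trans (cong (Σ (f x) +_) (sum-Σ f xs)) (sym (∑-distrib-+ (f x) _))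

-- The reference matching as an involution.

record Pairing {n} (G : Graph n) : Set where
  field
    covered   : Fin n → Bool
    star      : Fin n → Fin n
    star-star : ∀ u → star (star u) ≡ u
    star-adj  : ∀ {u} → covered ∋ u → adj G u (star u) ≡ true
    covered-star : ∀ u → covered (star u) ≡ covered u

module _ {n} {G : Graph n} where
  open Greedy G

  -- When a matching is itself used as the probe list, every probe succeeds and fills two new nodes,
  -- because no endpoint recurs.
  run-matching : ∀ M {s} → All (λ (u , v) → adj G u v ≡ true) M → Unique (endpoints M) → All (s ∌_) (endpoints M) →
                 Σ (⟦_⟧ ∘ s) + 2 * length M ≡ Σ (⟦_⟧ ∘ run M s)
  run-matching []            {s} _          _        _          = ℕ.+-identityʳ _
  run-matching ((u , v) ∷ M) {s} (uv ∷ es) (u∉ ∷ v∉ ∷ uq) (su ∷ sv ∷ ss) with probeView s u v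
  ... | miss _ m _ = true≢false refl (m uv su sv)
  ... | hit _ _ _ _ s′u s′v e = begin
    Σ (⟦_⟧ ∘ s) + 2 * suc (length M)     ≡⟨ arith (Σ (⟦_⟧ ∘ s)) (length M) ⟩
    Σ (⟦_⟧ ∘ s) + 1 + 1 + 2 * length M   ≡⟨ cong (_+ 2 * length M) (sym count) ⟩
    Σ (⟦_⟧ ∘ s′) + 2 * length M          ≡⟨ run-matching M es uq (All.zipWith still (All.zipWith id (All.tail u∉ , v∉) , ss)) ⟩
    Σ (⟦_⟧ ∘ run M s′)                   ∎
    where
    open ≡-Reasoning
    s′ = probe G s u v
    u≢v = adj⇒≢ uv
    arith : ∀ a b → a + 2 * suc b ≡ a + 1 + 1 + 2 * b
    arith = solve-∀
    still : ∀ {w} → (u ≢ w × v ≢ w) × s ∌ w → s′ ∌ w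
    still ((u≢w , v≢w) , sw) = trans (e _ (u≢w ∘ sym) (v≢w ∘ sym)) sw
    pointwise : ∀ w → ⟦ s′ w ⟧ ≡ ⟦ s w ⟧ + ⟦ does (u ≟ w) ⟧ * 1 + ⟦ does (v ≟ w) ⟧ * 1
    pointwise w with u ≟ w | v ≟ w
    ... | yes refl | yes v≡u  = contradiction (sym v≡u) u≢v
    ... | yes refl | no _     rewrite s′u | su = refl
    ... | no _     | yes refl rewrite s′v | sv = refl
    ... | no u≢w   | no v≢w   rewrite e w (u≢w ∘ sym) (v≢w ∘ sym) =
      sym (trans (ℕ.+-identityʳ _) (ℕ.+-identityʳ _))
    count : Σ (⟦_⟧ ∘ s′) ≡ Σ (⟦_⟧ ∘ s) + 1 + 1
    count = begin
      Σ (⟦_⟧ ∘ s′)                                       ≡⟨ sum-cong-≗ pointwise ⟩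
      Σ (λ w → ⟦ s w ⟧ + ⟦ does (u ≟ w) ⟧ * 1 + ⟦ does (v ≟ w) ⟧ * 1) ≡⟨ ∑-distrib-+ (λ w → ⟦ s w ⟧ + ⟦ does (u ≟ w) ⟧ * 1) _ ⟩
      Σ (λ w → ⟦ s w ⟧ + ⟦ does (u ≟ w) ⟧ * 1) + _       ≡⟨ cong₂ _+_ (∑-distrib-+ (⟦_⟧ ∘ s) _) (Σ-select (λ _ → 1) v) ⟩
      Σ (⟦_⟧ ∘ s) + _ + 1                                ≡⟨ cong (λ k → Σ (⟦_⟧ ∘ s) + k + 1) (Σ-select (λ _ → 1) u) ⟩
      Σ (⟦_⟧ ∘ s) + 1 + 1                                ∎

  -- The greedy run over `M` supplies the involution, so the facts about `mate` are reused; for a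
  -- matching `M` it covers exactly the endpoints of `M`.
  matching⇒pairing : Pairs → Pairing G
  matching⇒pairing M = record
    { covered   = run M ∅
    ; star      = mate M ∅
    ; star-star = mate-invol M
    ; star-adj  = λ p → mate-adj M (matched⇒mate≢ M refl p)
    ; covered-star = same
    }
    where
    same : ∀ u → run M ∅ (mate M ∅ u) ≡ run M ∅ u
    same u with run M ∅ u in e
    ... | true = mate≢⇒matched M (λ k → matched⇒mate≢ M {∅} {u} refl e (trans (sym k) (mate-invol M u)))
    ... | false = trans (cong (run M ∅) (free⇒mate≡ M e)) e

-- Double nodes.

DiffAt-unique : ∀ {n} {s t : Status n} {d e} → DiffAt s t d → s ∌ e → t ∋ e → e ≡ d
DiffAt-unique {d = d} {e} (_ , same) se te with e ≟ d
... | yes e≡d = e≡d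
... | no e≢d = true≢false (trans (same e e≢d) te) se

module Doubles {m} {G : Graph (suc m)} (I : Pairing G) {σ : Vec (Fin (suc m)) (suc m)} (inj : Injective σ) (j : Fin (suc m)) where
  open Ranking G
  open Pairing I

  private
    n = suc m
    matched? = matched σ
    p = partner σ
    without : Fin n → Status n
    without u = run (edges σ) (add ∅ u)

  lost : Fin n → Bool
  lost u = covered u ∧ not (matched (move (lookup σ u) j σ) u)

  double : Fin n → Bool
  double u = matched? u ∧ lost u ∧ not (matched? (star u))

  full : Fin n → Bool
  full u = double u ∧ double (p u)

  neither : Fin n → Bool
  neither u = matched? u ∧ not (double u) ∧ not (double (p u))

  ∧-∋ : ∀ {a b} → a ∧ b ≡ true → a ≡ true × b ≡ true
  ∧-∋ {true} {true} refl = refl , refl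

  star-injective : ∀ {u v} → star u ≡ star v → u ≡ v
  star-injective {u} {v} e = trans (sym (star-star u)) (trans (cong star e) (star-star v))

  p-invol : ∀ u → p (p u) ≡ u
  p-invol = mate-invol (edges σ)

  matched-p : ∀ {u} → matched? ∋ u → matched? ∋ p u
  matched-p {u} q = mate≢⇒matched (edges σ) (λ e → matched⇒mate≢ (edges σ) {∅} {u} refl q (trans (sym e) (p-invol u)))

  diff-without : ∀ u → Diff matched? (without u)
  diff-without u = diff-run (edges σ) (u , diff-add ∅ refl)

  record Double (u : Fin n) : Set where
    field
      star-free   : matched? ∌ star u
      star-gained : without u ∋ star u
      saturated   : ∀ {w} → adj G u w ≡ true → without u ∋ w

    diff-star : DiffAt matched? (without u) (star u)
    diff-star = diff-unique (diff-without u) (trans star-free (cong not (sym star-gained)))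

    only-star : ∀ {w} → adj G u w ≡ true → matched? ∌ w → w ≡ star u
    only-star uw free = DiffAt-unique diff-star free (saturated uw)

  -- Since `u` is free at rank `j`, `isolate-saturated` makes all its neighbours, `star u` among
  -- them, matched in the run without `u`.
  double⇒ : ∀ {u} → double ∋ u → Double u
  double⇒ {u} d with ∧-∋ {matched? u} d
  ... | _ , d′ with ∧-∋ d′
  ...   | l , f with ∧-∋ l
  ...     | c , g = record
    { star-free = not-injective f ; star-gained = sat (star-adj c) ; saturated = sat }
    where
    sat : ∀ {w} → adj G u w ≡ true → without u ∋ w
    sat = isolate-saturated {σ} inj u j (not-injective g)

  -- The last matched edge on the alternating path from `b` to `star b` joins `p y` and `y`, with
  -- `y` next to `star b`. Charging to `p y` records the edge and its direction, and blocking `p y`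
  -- has the same outcome as blocking `b`.
  full-charge : ∀ {b} → full ∋ b → ∃ λ x → neither ∋ x × (full ∋ b × without x ≗ without b)
  full-charge {b} fb with ∧-∋ fb
  ... | db , dpb with double⇒ db | double⇒ dpb
  ...   | B | B′ with alternating-end (edges σ) {∅} {add ∅ b} {star b} (λ _ → refl) (b , diff-add ∅ refl)
                       (star-free B) b≁ (star-gained B)
     where
     open Double
     b≁ : add ∅ b ∌ star b
     b≁ = add-other ∅ {b} {star b} (λ e → true≢false (proj₁ (∧-∋ db)) (trans (cong matched? (sym e)) (star-free B)))
  ...     | y , my , b∌y , yb* , same = p y , neither∋ , fb , same
    where
    open Double
    -- A double `y` would have `star b` as its free neighbour, so `star b` would be `star y` and `y`
    -- would be `b`.
    ¬dy : double y ≡ false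
    ¬dy with double y in dy
    ... | false = refl
    ... | true = true≢false (add-self ∅ b) (subst (add ∅ b ∌_)
          (sym (star-injective (only-star (double⇒ dy) yb* (star-free B)))) b∌y)
    -- A double `p y` would gain its `star` in the same final state as `b`, so it would be `b`; then
    -- `y` would be the partner of `b`, which is double.
    ¬dx : double (p y) ≡ false
    ¬dx with double (p y) in dx
    ... | false = refl
    ... | true = true≢false (subst (double ∋_) pb≡y dpb) ¬dy
      where
      X = double⇒ dx
      x≡b : p y ≡ b
      x≡b = star-injective (DiffAt-unique (diff-star B) (star-free X) (trans (sym (same _)) (star-gained X)))
      pb≡y : p b ≡ y
      pb≡y = trans (cong p (sym x≡b)) (p-invol y)
    neither∋ : neither ∋ p y
    neither∋ = cong₂ _∧_ (matched-p my) (cong₂ (λ a b → not a ∧ not b) ¬dx (trans (cong double (p-invol y)) ¬dy))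

  -- The node gained in the run without `x` is `star b`, so `x` determines `b`.
  charge-injective : ∀ {b b′ x} → full ∋ b × without x ≗ without b → full ∋ b′ × without x ≗ without b′ → b ≡ b′
  charge-injective (fb , e) (fb′ , e′) with double⇒ (proj₁ (∧-∋ fb)) | double⇒ (proj₁ (∧-∋ fb′))
  ... | B | B′ = star-injective (DiffAt-unique (diff-star B′) (star-free B)
                   (trans (sym (e′ _)) (trans (e _) (star-gained B))))
    where open Double

  -- Each double node is counted at itself and at its partner. Only full nodes are counted twice and
  -- `neither` nodes not at all, and `full-charge` maps the former injectively to the latter.
  double-count : 2 * Σ (⟦_⟧ ∘ double) ≤ Σ (⟦_⟧ ∘ matched?)
  double-count = ℕ.+-cancelʳ-≤ (Σ (⟦_⟧ ∘ neither)) _ _ (begin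
    2 * Σ (⟦_⟧ ∘ double) + Σ (⟦_⟧ ∘ neither)
      ≡⟨ cong (λ k → Σ (⟦_⟧ ∘ double) + k + Σ (⟦_⟧ ∘ neither)) (trans (ℕ.+-identityʳ _) (sym (Σ-involution (⟦_⟧ ∘ double) p p-invol))) ⟩
    Σ (⟦_⟧ ∘ double) + Σ (⟦_⟧ ∘ double ∘ p) + Σ (⟦_⟧ ∘ neither)
      ≡⟨ cong (_+ Σ (⟦_⟧ ∘ neither)) (∑-distrib-+ (⟦_⟧ ∘ double) (⟦_⟧ ∘ double ∘ p)) ⟨
    Σ (λ u → ⟦ double u ⟧ + ⟦ double (p u) ⟧) + Σ (⟦_⟧ ∘ neither)
      ≡⟨ ∑-distrib-+ (λ u → ⟦ double u ⟧ + ⟦ double (p u) ⟧) (⟦_⟧ ∘ neither) ⟨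
    Σ (λ u → ⟦ double u ⟧ + ⟦ double (p u) ⟧ + ⟦ neither u ⟧)
      ≤⟨ Σ-mono pointwise ⟩
    Σ (λ u → ⟦ matched? u ⟧ + ⟦ full u ⟧)
      ≡⟨ ∑-distrib-+ (⟦_⟧ ∘ matched?) (⟦_⟧ ∘ full) ⟩
    Σ (⟦_⟧ ∘ matched?) + Σ (⟦_⟧ ∘ full)
      ≤⟨ ℕ.+-monoʳ-≤ (Σ (⟦_⟧ ∘ matched?)) (Σ-injection (λ b x → full ∋ b × without x ≗ without b) full-charge charge-injective) ⟩
    Σ (⟦_⟧ ∘ matched?) + Σ (⟦_⟧ ∘ neither) ∎)
    where
    open ℕ.≤-Reasoning
    pointwise : ∀ u → ⟦ double u ⟧ + ⟦ double (p u) ⟧ + ⟦ neither u ⟧ ≤ ⟦ matched? u ⟧ + ⟦ full u ⟧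
    pointwise u with matched? u in e
    ... | false rewrite free⇒mate≡ (edges σ) {∅} {u} e | e = z≤n
    ... | true with lost u ∧ not (matched? (star u)) | double (p u)
    ...   | true  | true  = ℕ.≤-refl
    ...   | true  | false = ℕ.≤-refl
    ...   | false | true  = ℕ.≤-refl
    ...   | false | false = ℕ.≤-refl

  -- A lost node is matched or missed. A missed node is charged to its `star`, which is matched by
  -- maximality; a node that counts both for itself and for its `star` is double.
  lost-count : 2 * Σ (⟦_⟧ ∘ lost) ≤ 3 * Σ (⟦_⟧ ∘ matched?)
  lost-count = begin
    2 * Σ (⟦_⟧ ∘ lost)                                   ≤⟨ ℕ.*-monoʳ-≤ 2 lost≤ ⟩
    2 * (Σ (⟦_⟧ ∘ matched?) + Σ (⟦_⟧ ∘ double))          ≡⟨ ℕ.*-distribˡ-+ 2 (Σ (⟦_⟧ ∘ matched?)) _ ⟩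
    2 * Σ (⟦_⟧ ∘ matched?) + 2 * Σ (⟦_⟧ ∘ double)        ≤⟨ ℕ.+-monoʳ-≤ (2 * Σ (⟦_⟧ ∘ matched?)) double-count ⟩
    2 * Σ (⟦_⟧ ∘ matched?) + Σ (⟦_⟧ ∘ matched?)          ≡⟨ arith (Σ (⟦_⟧ ∘ matched?)) ⟩
    3 * Σ (⟦_⟧ ∘ matched?)                               ∎
    where
    open ℕ.≤-Reasoning
    arith : ∀ a → 2 * a + a ≡ 3 * a
    arith = solve-∀
    missed : Fin n → Bool
    missed u = covered u ∧ not (matched? u)
    split : ∀ u → ⟦ lost u ⟧ ≤ ⟦ matched? u ∧ lost u ⟧ + ⟦ missed u ⟧
    split u with matched? u | covered u
    ... | true  | _     = ℕ.m≤m+n _ _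
    ... | false | false = z≤n
    ... | false | true with not (matched (move (lookup σ u) j σ) u)
    ...   | true = ℕ.≤-refl
    ...   | false = z≤n
    merge : ∀ u → ⟦ matched? u ∧ lost u ⟧ + ⟦ missed (star u) ⟧ ≤ ⟦ matched? u ⟧ + ⟦ double u ⟧
    merge u rewrite covered-star u with matched? u in e | covered u in c | matched? (star u) in f
    ... | true  | false | _     = z≤n
    ... | true  | true  | true  with not (matched (move (lookup σ u) j σ) u)
    ...   | true = ℕ.≤-refl
    ...   | false = z≤n
    merge u | true | true | false with not (matched (move (lookup σ u) j σ) u)
    ...   | true = ℕ.≤-refl
    ...   | false = ℕ.≤-refl
    merge u | false | false | _ = z≤n
    merge u | false | true | true = z≤n
    merge u | false | true | false = contradiction (free⇒mate≡ (edges σ) f)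
      (proj₁ (partner-before {σ} inj u j e (star-adj c)))
    lost≤ : Σ (⟦_⟧ ∘ lost) ≤ Σ (⟦_⟧ ∘ matched?) + Σ (⟦_⟧ ∘ double)
    lost≤ = begin
      Σ (⟦_⟧ ∘ lost)                                                    ≤⟨ Σ-mono split ⟩
      Σ (λ u → ⟦ matched? u ∧ lost u ⟧ + ⟦ missed u ⟧)                  ≡⟨ ∑-distrib-+ (λ u → ⟦ matched? u ∧ lost u ⟧) (⟦_⟧ ∘ missed) ⟩
      Σ (λ u → ⟦ matched? u ∧ lost u ⟧) + Σ (⟦_⟧ ∘ missed)              ≡⟨ cong (Σ (λ u → ⟦ matched? u ∧ lost u ⟧) +_) (Σ-involution (⟦_⟧ ∘ missed) star star-star) ⟨
      Σ (λ u → ⟦ matched? u ∧ lost u ⟧) + Σ (⟦_⟧ ∘ missed ∘ star)       ≡⟨ ∑-distrib-+ (λ u → ⟦ matched? u ∧ lost u ⟧) (⟦_⟧ ∘ missed ∘ star) ⟨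
      Σ (λ u → ⟦ matched? u ∧ lost u ⟧ + ⟦ missed (star u) ⟧)           ≤⟨ Σ-mono merge ⟩
      Σ (λ u → ⟦ matched? u ⟧ + ⟦ double u ⟧)                           ≡⟨ ∑-distrib-+ (⟦_⟧ ∘ matched?) (⟦_⟧ ∘ double) ⟩
      Σ (⟦_⟧ ∘ matched?) + Σ (⟦_⟧ ∘ double)                             ∎

-- Sums over initial segments of the ranks.

Σ-const : ∀ n c → Σ {n} (λ _ → c) ≡ n * c
Σ-const zero    c = refl
Σ-const (suc n) c = cong (c +_) (Σ-const n c)

Σ-*ʳ : ∀ {n} (f : Fin n → ℕ) c → Σ (λ i → f i * c) ≡ Σ f * c
Σ-*ʳ {zero}  f c = refl
Σ-*ʳ {suc n} f c = trans (cong (f Fin.zero * c +_) (Σ-*ʳ (f ∘ Fin.suc) c))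
  (sym (ℕ.*-distribʳ-+ c (f Fin.zero) _))

⟦⟧*-Σ : ∀ {n} b (f g : Fin n → ℕ) → (∀ u → f u ≤ g u) → ∀ (a : Fin n → ℕ) →
        Σ (λ u → a u * (⟦ b ⟧ * f u)) ≤ ⟦ b ⟧ * Σ (λ u → a u * g u)
⟦⟧*-Σ {n} false f g h a = ℕ.≤-reflexive (Σ-zero {n} (λ u → ℕ.*-zeroʳ (a u)))
⟦⟧*-Σ true  f g h a = ℕ.≤-trans
  (Σ-mono (λ u → ℕ.*-monoʳ-≤ (a u) (ℕ.≤-trans (ℕ.≤-reflexive (ℕ.*-identityˡ (f u))) (h u))))
  (ℕ.≤-reflexive (sym (ℕ.*-identityˡ _)))

below : ∀ {n} → Fin n → ℕ → Bool
below i k = toℕ i <ᵇ k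

below⁺ : ∀ {n} {i : Fin n} {k} → toℕ i < k → below i k ≡ true
below⁺ p = Equivalence.to T-≡ (ℕ.<⇒<ᵇ p)

below⁻ : ∀ {n} {i : Fin n} {k} → k ≤ toℕ i → below i k ≡ false
below⁻ {i = i} {k} p with below i k in e
... | false = refl
... | true = contradiction p (ℕ.<⇒≱ (ℕ.<ᵇ⇒< (toℕ i) k (Equivalence.from T-≡ e)))

count-not-below : ∀ n k → k ≤ n → Σ {n} (λ i → ⟦ not (below i k) ⟧) + k ≡ n
count-not-below zero    zero    _       = refl
count-not-below (suc n) zero    _       = cong suc (count-not-below n zero z≤n)
count-not-below (suc n) (suc k) (s≤s p) = trans (ℕ.+-suc _ k) (cong suc (count-not-below n k p))

prefix : ∀ {n} → (Fin n → ℕ) → ℕ → ℕ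
prefix x k = Σ (λ i → ⟦ below i k ⟧ * x i)

prefix-all : ∀ {n} (x : Fin n → ℕ) → prefix x n ≡ Σ x
prefix-all {n} x = sum-cong-≗ pointwise
  where
  pointwise : ∀ i → ⟦ below i n ⟧ * x i ≡ x i
  pointwise i = trans (cong (λ b → ⟦ b ⟧ * x i) (below⁺ {i = i} (Fin.toℕ<n i))) (ℕ.*-identityˡ (x i))

prefix-suc : ∀ {n} (x : Fin n → ℕ) t → prefix x (suc (toℕ t)) ≡ prefix x (toℕ t) + x t
prefix-suc {n} x t = begin
  prefix x (suc (toℕ t))                                   ≡⟨ sum-cong-≗ pointwise ⟩
  Σ (λ i → ⟦ below i (toℕ t) ⟧ * x i + ⟦ does (t ≟ i) ⟧ * x i) ≡⟨ ∑-distrib-+ (λ i → ⟦ below i (toℕ t) ⟧ * x i) (λ i → ⟦ does (t ≟ i) ⟧ * x i) ⟩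
  prefix x (toℕ t) + Σ (λ i → ⟦ does (t ≟ i) ⟧ * x i)      ≡⟨ cong (prefix x (toℕ t) +_) (Σ-select x t) ⟩
  prefix x (toℕ t) + x t                                   ∎
  where
  open ≡-Reasoning
  pointwise : ∀ i → ⟦ below i (suc (toℕ t)) ⟧ * x i ≡ ⟦ below i (toℕ t) ⟧ * x i + ⟦ does (t ≟ i) ⟧ * x i
  pointwise i with t ≟ i
  ... | yes refl rewrite below⁺ {i = i} (ℕ.n<1+n (toℕ i)) | below⁻ {i = i} (ℕ.≤-refl {toℕ i}) = refl
  ... | no t≢i with ℕ.<-cmp (toℕ i) (toℕ t)
  ...   | tri< p _ _ rewrite below⁺ {i = i} (ℕ.m<n⇒m<1+n p) | below⁺ {i = i} p = sym (ℕ.+-identityʳ _)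
  ...   | tri≈ _ e _ = contradiction (Fin.toℕ-injective (sym e)) t≢i
  ...   | tri> _ _ p rewrite below⁻ {i = i} p | below⁻ {i = i} (ℕ.<⇒≤ p) = refl

length-filter-tabulate : ∀ {n} {A : Set} (b : A → Bool) (f : Fin n → A) →
                         length (filter (λ a → T? (b a)) (tabulate f)) ≡ Σ (⟦_⟧ ∘ b ∘ f)
length-filter-tabulate {zero}  b f = refl
length-filter-tabulate {suc n} b f with b (f Fin.zero)
... | true  = cong suc (length-filter-tabulate b (f ∘ Fin.suc))
... | false = length-filter-tabulate b (f ∘ Fin.suc)

-- The evolving and boundary constraints.

module Program {m} {G : Graph (suc m)} (I : Pairing G) where
  open Ranking G
  open Pairing I

  private
    n = suc m
    Perm = Vec (Fin n) n
    perms = permutations n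

  -- For a permutation `σ` one node has rank `t`; the sum over all nodes avoids inverting `σ`.
  at : Fin n → Perm → ℕ
  at t σ = Σ (λ u → ⟦ does (lookup σ u ≟ t) ⟧ * ⟦ matched σ u ⟧)

  x : Fin n → ℕ
  x t = sum (map (at t) perms)

  total : ℕ
  total = length perms * Σ (⟦_⟧ ∘ covered)

  last : Fin n
  last = Fin.fromℕ m

  x-move : ∀ i t → sum (map (at t ∘ move i t) perms) ≡ x t
  x-move i t = sum-relabel (shift i t) (at t)

  matched-total : ∀ σ → Σ (λ t → at t σ) ≡ Σ (⟦_⟧ ∘ matched σ)
  matched-total σ = sym (Σ-fibres (lookup σ) (λ _ → ⟦_⟧ ∘ matched σ))

  total-x : Σ x ≡ sum (map (λ σ → Σ (⟦_⟧ ∘ matched σ)) perms)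
  total-x = trans (sym (sum-Σ (λ σ t → at t σ) perms)) (cong sum (map-cong matched-total perms))

  total-Σ : Σ x ≡ totalMatched G
  total-Σ = trans total-x (cong sum (map-cong count perms))
    where
    count : ∀ σ → Σ (⟦_⟧ ∘ matched σ) ≡ rankingMatched G σ
    count σ = trans (sum-cong-≗ (λ u → cong (λ s → ⟦ s u ⟧) (sym (runRanking≡run (byRank σ) ∅))))
      (sym (length-filter-tabulate (runRanking G (byRank σ) ∅) (λ u → u)))

  -- A matched node of last rank stays matched when promoted to rank `t`, and the move from `last`
  -- to `t` permutes the permutations.
  x-last : ∀ t → x last ≤ x t
  x-last t = ℕ.≤-trans (sum-mono perms (λ {σ} σ∈ → Σ-mono (pointwise σ (∈-permutations⁻ σ∈))))
    (ℕ.≤-reflexive (x-move last t))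
    where
    pointwise : ∀ σ → Injective σ → ∀ u → ⟦ does (lookup σ u ≟ last) ⟧ * ⟦ matched σ u ⟧ ≤
                ⟦ does (lookup (move last t σ) u ≟ t) ⟧ * ⟦ matched (move last t σ) u ⟧
    pointwise σ inj u with lookup σ u ≟ last
    ... | no _ = z≤n
    ... | yes e with matched σ u in mu
    ...   | false = z≤n
    ...   | true with lookup (move last t σ) u ≟ t | matched (move last t σ) u in mu′
    ...     | no ne | _ = contradiction (subst (λ l → lookup (move l t σ) u ≡ t) e (rank-move-self {σ} inj u t)) ne
    ...     | yes _ | true = ℕ.≤-refl
    ...     | yes _ | false = true≢false (subst (λ l → matched (move l t σ) ∋ u) e
                (matched-promote {σ} inj u t (subst (λ l → toℕ t ≤ toℕ l) (sym e) (Fin.≤fromℕ t)) mu)) mu′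

  -- Grouping the nodes by their rank `i` in `σ` makes the moved permutation independent of the
  -- node; the node of rank `i` then has rank `t`.
  moved : ∀ {σ} → Injective σ → ∀ t (b : Fin n → Bool) →
          Σ (λ u → ⟦ b (lookup σ u) ⟧ * ⟦ matched (move (lookup σ u) t σ) u ⟧) ≤
          Σ (λ i → ⟦ b i ⟧ * at t (move i t σ))
  moved {σ} inj t b = ℕ.≤-trans
    (ℕ.≤-reflexive (Σ-fibres (lookup σ) (λ i u → ⟦ b i ⟧ * ⟦ matched (move i t σ) u ⟧)))
    (Σ-mono (λ i → ℕ.≤-trans
      (⟦⟧*-Σ (b i) (λ u → ⟦ matched (move i t σ) u ⟧) (λ u → ⟦ matched (move i t σ) u ⟧) (λ _ → ℕ.≤-refl) (λ u → ⟦ does (lookup σ u ≟ i) ⟧))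
      (ℕ.*-monoʳ-≤ ⟦ b i ⟧ (Σ-mono (λ u → ℕ.*-monoˡ-≤ ⟦ matched (move i t σ) u ⟧ (pointwise i u))))))
    where
    pointwise : ∀ i u → ⟦ does (lookup σ u ≟ i) ⟧ ≤ ⟦ does (lookup (move i t σ) u ≟ t) ⟧
    pointwise i u with lookup σ u ≟ i
    ... | no _ = z≤n
    ... | yes refl with lookup (move (lookup σ u) t σ) u ≟ t
    ...   | yes _ = ℕ.≤-refl
    ...   | no ne = contradiction (rank-move-self {σ} inj u t) ne

  -- A covered node not accounted for by its own match is charged to the partner of its `star`,
  -- which has rank below `t`. This charge is a composition of two involutions, so the early matched
  -- nodes count at most twice.
  evolving-at : ∀ {σ} → Injective σ → ∀ t →
    Σ (⟦_⟧ ∘ covered) ≤ Σ (λ i → ⟦ not (below i (toℕ t)) ⟧ * at t (move i t σ)) +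
                        (Σ (λ i → ⟦ below i (toℕ t) ⟧ * at i σ) + Σ (λ i → ⟦ below i (toℕ t) ⟧ * at i σ))
  evolving-at {σ} inj t = begin
    Σ (⟦_⟧ ∘ covered)                                   ≤⟨ Σ-mono pointwise ⟩
    Σ (λ u → late u + (early u + early (f u)))          ≡⟨ ∑-distrib-+ late (λ u → early u + early (f u)) ⟩
    Σ late + Σ (λ u → early u + early (f u))            ≡⟨ cong (Σ late +_) (∑-distrib-+ early (early ∘ f)) ⟩
    Σ late + (Σ early + Σ (early ∘ f))                  ≡⟨ cong (λ k → Σ late + (Σ early + k)) permuted ⟩
    Σ late + (Σ early + Σ early)                        ≤⟨ ℕ.+-mono-≤ (moved {σ} inj t (λ i → not (below i (toℕ t)))) (ℕ.+-mono-≤ early≤ early≤) ⟩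
    _                                                   ∎
    where
    open ℕ.≤-Reasoning
    f : Fin n → Fin n
    f = partner σ ∘ star
    late early : Fin n → ℕ
    late u = ⟦ not (below (lookup σ u) (toℕ t)) ⟧ * ⟦ matched (move (lookup σ u) t σ) u ⟧
    early u = ⟦ below (lookup σ u) (toℕ t) ⟧ * ⟦ matched σ u ⟧
    permuted : Σ (early ∘ f) ≡ Σ early
    permuted = trans (Σ-involution (early ∘ partner σ) star star-star)
      (Σ-involution early (partner σ) (mate-invol (edges σ)))
    early≤ : Σ early ≤ Σ (λ i → ⟦ below i (toℕ t) ⟧ * at i σ)
    early≤ = ℕ.≤-trans
      (ℕ.≤-reflexive (Σ-fibres (lookup σ) (λ i u → ⟦ below i (toℕ t) ⟧ * ⟦ matched σ u ⟧)))
      (Σ-mono (λ i → ⟦⟧*-Σ (below i (toℕ t)) (⟦_⟧ ∘ matched σ) (⟦_⟧ ∘ matched σ) (λ _ → ℕ.≤-refl) (λ u → ⟦ does (lookup σ u ≟ i) ⟧)))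
    early-f : ∀ u → matched σ ∋ f u × rank σ (f u) < toℕ t → 1 ≤ early (f u)
    early-f u (mv , lt) = ℕ.≤-reflexive (sym (cong₂ (λ a b → ⟦ a ⟧ * ⟦ b ⟧) (below⁺ {i = lookup σ (f u)} lt) mv))
    pointwise : ∀ u → ⟦ covered u ⟧ ≤ late u + (early u + early (f u))
    pointwise u with covered u in c
    ... | false = z≤n
    ... | true with rank σ u ℕ.<? toℕ t
    ...   | yes lt rewrite below⁺ {i = lookup σ u} lt with matched σ u in mu
    ...     | true = s≤s z≤n
    ...     | false = early-f u (partner-early {σ} inj t (star-adj c) (inj₁ (lt , mu)))
    pointwise u | true | no ge rewrite below⁻ {i = lookup σ u} (ℕ.≮⇒≥ ge)
            with matched (move (lookup σ u) t σ) u in mu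
    ...     | true = s≤s z≤n
    ...     | false = early-f u (partner-early {σ} inj t (star-adj c) (inj₂ (ℕ.≮⇒≥ ge , mu)))

  -- For each of the n - t ranks `i` from `t` on, `x-move` turns the sum of the moved terms into
  -- `x t`.
  evolving : ∀ t → total ≤ Σ {n} (λ i → ⟦ not (below i (toℕ t)) ⟧) * x t + (prefix x (toℕ t) + prefix x (toℕ t))
  evolving t = begin
    total                                                      ≡⟨ sum-const (Σ (⟦_⟧ ∘ covered)) perms ⟨
    sum (map (λ _ → Σ (⟦_⟧ ∘ covered)) perms)                  ≤⟨ sum-mono perms (λ {σ} σ∈ → evolving-at {σ} (∈-permutations⁻ σ∈) t) ⟩
    sum (map (λ σ → F σ + (H σ + H σ)) perms)                  ≡⟨ sum-+ F (λ σ → H σ + H σ) perms ⟩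
    sum (map F perms) + sum (map (λ σ → H σ + H σ) perms)      ≡⟨ cong₂ _+_ F≡ (trans (sum-+ H H perms) (cong₂ _+_ H≡ H≡)) ⟩
    _                                                          ∎
    where
    open ℕ.≤-Reasoning
    F H : Perm → ℕ
    F σ = Σ (λ i → ⟦ not (below i (toℕ t)) ⟧ * at t (move i t σ))
    H σ = Σ (λ i → ⟦ below i (toℕ t) ⟧ * at i σ)
    F≡ : sum (map F perms) ≡ Σ {n} (λ i → ⟦ not (below i (toℕ t)) ⟧) * x t
    F≡ = trans (sum-Σ (λ σ i → ⟦ not (below i (toℕ t)) ⟧ * at t (move i t σ)) perms)
      (trans (sum-cong-≗ (λ i → trans (sum-* ⟦ not (below i (toℕ t)) ⟧ (at t ∘ move i t) perms)
                                      (cong (⟦ not (below i (toℕ t)) ⟧ *_) (x-move i t))))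
             (Σ-*ʳ {n} (λ i → ⟦ not (below i (toℕ t)) ⟧) (x t)))
    H≡ : sum (map H perms) ≡ prefix x (toℕ t)
    H≡ = trans (sum-Σ (λ σ i → ⟦ below i (toℕ t) ⟧ * at i σ) perms)
      (sum-cong-≗ (λ i → sum-* ⟦ below i (toℕ t) ⟧ (at i) perms))

  boundary-at : ∀ {σ} → Injective σ →
    2 * Σ (⟦_⟧ ∘ covered) ≤ 2 * Σ (λ i → 1 * at last (move i last σ)) + 3 * Σ (⟦_⟧ ∘ matched σ)
  boundary-at {σ} inj = begin
    2 * Σ (⟦_⟧ ∘ covered)                         ≤⟨ ℕ.*-monoʳ-≤ 2 (Σ-mono pointwise) ⟩
    2 * Σ (λ u → kept u + ⟦ lost u ⟧)             ≡⟨ cong (2 *_) (∑-distrib-+ kept (⟦_⟧ ∘ lost)) ⟩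
    2 * (Σ kept + Σ (⟦_⟧ ∘ lost))                 ≡⟨ ℕ.*-distribˡ-+ 2 (Σ kept) (Σ (⟦_⟧ ∘ lost)) ⟩
    2 * Σ kept + 2 * Σ (⟦_⟧ ∘ lost)               ≤⟨ ℕ.+-mono-≤ (ℕ.*-monoʳ-≤ 2 (moved {σ} inj last (λ _ → true))) lost-count ⟩
    _                                             ∎
    where
    open ℕ.≤-Reasoning
    open Doubles I {σ} inj last
    kept : Fin n → ℕ
    -- The factor `1` is the indicator of all ranks, the shape in which `moved` is applied.
    kept u = 1 * ⟦ matched (move (lookup σ u) last σ) u ⟧
    pointwise : ∀ u → ⟦ covered u ⟧ ≤ kept u + ⟦ lost u ⟧
    pointwise u with covered u | matched (move (lookup σ u) last σ) u
    ... | false | _     = z≤n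
    ... | true  | true  = ℕ.≤-refl
    ... | true  | false = ℕ.≤-refl

  boundary : 2 * total ≤ 2 * (n * x last) + 3 * Σ x
  boundary = begin
    2 * total                                                     ≡⟨ cong (2 *_) (sum-const (Σ (⟦_⟧ ∘ covered)) perms) ⟨
    2 * sum (map (λ _ → Σ (⟦_⟧ ∘ covered)) perms)                 ≡⟨ sum-* 2 (λ _ → Σ (⟦_⟧ ∘ covered)) perms ⟨
    sum (map (λ _ → 2 * Σ (⟦_⟧ ∘ covered)) perms)                 ≤⟨ sum-mono perms (λ {σ} σ∈ → boundary-at {σ} (∈-permutations⁻ σ∈)) ⟩
    sum (map (λ σ → 2 * F σ + 3 * Σ (⟦_⟧ ∘ matched σ)) perms)     ≡⟨ sum-+ (λ σ → 2 * F σ) (λ σ → 3 * Σ (⟦_⟧ ∘ matched σ)) perms ⟩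
    _                                                             ≡⟨ cong₂ _+_ (sum-* 2 F perms) (sum-* 3 (λ σ → Σ (⟦_⟧ ∘ matched σ)) perms) ⟩
    _                                                             ≡⟨ cong₂ (λ a b → 2 * a + 3 * b) F≡ (sym total-x) ⟩
    2 * (n * x last) + 3 * Σ x                                    ∎
    where
    open ℕ.≤-Reasoning
    F : Perm → ℕ
    F σ = Σ (λ i → 1 * at last (move i last σ))
    F≡ : sum (map F perms) ≡ n * x last
    F≡ = trans (sum-Σ (λ σ i → 1 * at last (move i last σ)) perms)
      (trans (sum-cong-≗ (λ i → trans (sum-* 1 (at last ∘ move i last) perms)
                 (trans (ℕ.*-identityˡ _) (x-move i last))))
             (Σ-const n (x last)))

-- Solving the linear program.

module _ {y t : ℕ} where

  ratio-≤ : 2 * y ≤ 3 * t → RatioAtLeastBound t y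
  ratio-≤ h = begin
    (10 * y ∸ 9 * t) ^ 2   ≤⟨ ℕ.^-monoˡ-≤ 2 (ℕ.m≤n+o⇒m∸n≤o (10 * y) (9 * t) (begin
      10 * y                 ≡⟨ split y ⟩
      3 * (2 * y) + 4 * y    ≤⟨ ℕ.+-monoˡ-≤ (4 * y) (ℕ.*-monoʳ-≤ 3 h) ⟩
      3 * (3 * t) + 4 * y    ≡⟨ cong (_+ 4 * y) (ℕ.*-assoc 3 3 t) ⟨
      9 * t + 4 * y          ∎)) ⟩
    (4 * y) ^ 2            ≡⟨ square y ⟩
    16 * y ^ 2             ≤⟨ ℕ.*-monoˡ-≤ (y ^ 2) {16} {28} (ℕ.m≤m+n 16 12) ⟩
    28 * y ^ 2             ∎
    where
    open ℕ.≤-Reasoning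
    split : ∀ y → 10 * y ≡ 3 * (2 * y) + 4 * y
    split = solve-∀
    square : ∀ y → 4 * y * (4 * y * 1) ≡ 16 * (y * (y * 1))
    square = solve-∀

  -- Inserting 3 t = 2 y - d and d ≤ 2 w into the quadratic inequality gives `key`. As 10 y - 9 t =
  -- 4 y + 3 d, completing the square yields the bound.
  ratio-quadratic : ∀ {w d} → 3 * t + d ≡ 2 * y → d ≤ 2 * w → y * y + w * w ≤ 2 * (t * y) →
                    RatioAtLeastBound t y
  ratio-quadratic {w} {d} e d≤ q = begin
    (10 * y ∸ 9 * t) ^ 2                   ≡⟨ cong (_^ 2) difference ⟩
    (4 * y + 3 * d) ^ 2                    ≡⟨ expand y d ⟩
    16 * y ^ 2 + 3 * (3 * (d * d) + 8 * (d * y))  ≤⟨ ℕ.+-monoʳ-≤ (16 * y ^ 2) (ℕ.*-monoʳ-≤ 3 key) ⟩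
    16 * y ^ 2 + 3 * (4 * (y * y))         ≡⟨ collect y ⟩
    28 * y ^ 2                             ∎
    where
    open ℕ.≤-Reasoning
    expand : ∀ y d → (4 * y + 3 * d) * ((4 * y + 3 * d) * 1) ≡ 16 * (y * (y * 1)) + 3 * (3 * (d * d) + 8 * (d * y))
    expand = solve-∀
    collect : ∀ y → 16 * (y * (y * 1)) + 3 * (4 * (y * y)) ≡ 28 * (y * (y * 1))
    collect = solve-∀
    difference : 10 * y ∸ 9 * t ≡ 4 * y + 3 * d
    difference = trans (cong (_∸ 9 * t) (trans (a₁ y) (trans (cong (λ k → 4 * y + 3 * k) (sym e)) (a₂ y t d))))
      (ℕ.m+n∸m≡n (9 * t) (4 * y + 3 * d))
      where
      a₁ : ∀ y → 10 * y ≡ 4 * y + 3 * (2 * y)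
      a₁ = solve-∀
      a₂ : ∀ y t d → 4 * y + 3 * (3 * t + d) ≡ 9 * t + (4 * y + 3 * d)
      a₂ = solve-∀
    key : 3 * (d * d) + 8 * (d * y) ≤ 4 * (y * y)
    key = ℕ.+-cancelˡ-≤ (12 * (y * y)) _ _ (begin
      12 * (y * y) + (3 * (d * d) + 8 * (d * y))               ≤⟨ ℕ.+-monoʳ-≤ (12 * (y * y)) (ℕ.+-monoˡ-≤ (8 * (d * y)) (ℕ.*-monoʳ-≤ 3 (ℕ.*-mono-≤ d≤ d≤))) ⟩
      12 * (y * y) + (3 * (2 * w * (2 * w)) + 8 * (d * y))     ≡⟨ a₁ y w d ⟩
      12 * (y * y + w * w) + 8 * (d * y)                       ≤⟨ ℕ.+-monoˡ-≤ (8 * (d * y)) (ℕ.*-monoʳ-≤ 12 q) ⟩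
      12 * (2 * (t * y)) + 8 * (d * y)                         ≡⟨ a₂ y t d ⟩
      8 * ((3 * t + d) * y)                                    ≡⟨ cong (λ k → 8 * (k * y)) e ⟩
      8 * (2 * y * y)                                          ≡⟨ a₃ y ⟩
      12 * (y * y) + 4 * (y * y)                               ∎)
      where
      a₁ : ∀ y w d → 12 * (y * y) + (3 * (2 * w * (2 * w)) + 8 * (d * y)) ≡ 12 * (y * y + w * w) + 8 * (d * y)
      a₁ = solve-∀
      a₂ : ∀ y t d → 12 * (2 * (t * y)) + 8 * (d * y) ≡ 8 * ((3 * t + d) * y)
      a₂ = solve-∀
      a₃ : ∀ y → 8 * (2 * y * y) ≡ 12 * (y * y) + 4 * (y * y)
      a₃ = solve-∀

-- There are `suc N` ranks, `P k` is the sum of x over the first `k` of them, and `suc m` ranks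
-- remain. `evolve` is the evolving constraint for x k = P (suc k) - P k, cleared of subtraction;
-- `w` bounds each x k from below.
module _ (N : ℕ) .{{_ : NonZero N}} (P : ℕ → ℕ) {y w : ℕ}
         (evolve : ∀ k m → k + suc m ≡ suc N → y + suc m * P k ≤ suc m * P (suc k) + 2 * P k)
         (low : ∀ k m → k + suc m ≡ suc N → P k + w ≤ P (suc k)) where

  private
    C = suc N * N

  -- With equality in the evolving constraints,
  -- P k = (y / 2) (1 − m (m − 1) / (n (n − 1))), where m = n − k.
  prefix-bound : ∀ k m → k + suc m ≡ suc N → C * y ≤ 2 * (C * P k) + suc m * m * y
  prefix-bound zero    .N refl = ℕ.m≤n+m (C * y) (2 * (C * P 0))
  prefix-bound (suc k) m eq = ℕ.*-cancelˡ-≤ (2 + m) (ℕ.+-cancelʳ-≤ (2 * C * (m * P k)) _ _ (begin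
    (2 + m) * (C * y) + 2 * C * (m * P k)
      ≡⟨ a₁ C y m (P k) ⟩
    2 * C * (y + m * P k) + m * (C * y)
      ≤⟨ ℕ.+-mono-≤ (ℕ.*-monoʳ-≤ (2 * C) step) (ℕ.*-monoʳ-≤ m (prefix-bound k (suc m) eq′)) ⟩
    2 * C * ((2 + m) * P (suc k)) + m * (2 * (C * P k) + (2 + m) * (1 + m) * y)
      ≡⟨ a₂ C y m (P k) (P (suc k)) ⟩
    (2 + m) * (2 * (C * P (suc k)) + suc m * m * y) + 2 * C * (m * P k) ∎))
    where
    open ℕ.≤-Reasoning
    eq′ : k + suc (suc m) ≡ suc N
    eq′ = trans (ℕ.+-suc k (suc m)) eq
    a₁ : ∀ C y m p → (2 + m) * (C * y) + 2 * C * (m * p) ≡ 2 * C * (y + m * p) + m * (C * y)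
    a₁ = solve-∀
    a₂ : ∀ C y m p q → 2 * C * ((2 + m) * q) + m * (2 * (C * p) + (2 + m) * (1 + m) * y) ≡
                       (2 + m) * (2 * (C * q) + suc m * m * y) + 2 * C * (m * p)
    a₂ = solve-∀
    a₃ : ∀ y m p → y + m * p + 2 * p ≡ y + (2 + m) * p
    a₃ = solve-∀
    -- The constraint for the previous prefix, where `2 + m` ranks remain. The factor `m` of `P k`
    -- is not negative, so the lower bound for `P k` can be inserted.
    step : y + m * P k ≤ (2 + m) * P (suc k)
    step = ℕ.+-cancelʳ-≤ (2 * P k) _ _ (ℕ.≤-trans (ℕ.≤-reflexive (a₃ y m (P k))) (evolve k (suc m) eq′))

  suffix-bound : ∀ k m → k + m ≡ suc N → P k + m * w ≤ P (suc N)
  suffix-bound k zero    eq = ℕ.≤-reflexive (trans (ℕ.+-identityʳ (P k)) (cong P (trans (sym (ℕ.+-identityʳ k)) eq)))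
  suffix-bound k (suc m) eq = begin
    P k + (w + m * w)   ≡⟨ ℕ.+-assoc (P k) w (m * w) ⟨
    P k + w + m * w     ≤⟨ ℕ.+-monoˡ-≤ (m * w) (low k m eq) ⟩
    P (suc k) + m * w   ≤⟨ suffix-bound (suc k) m (trans (sym (ℕ.+-suc k m)) eq) ⟩
    P (suc N)           ∎
    where open ℕ.≤-Reasoning

  private
    W = suc N * w
    S = P (suc N)

  last-bound : W ≤ S
  last-bound = ℕ.≤-trans (ℕ.m≤n+m W (P 0)) (suffix-bound 0 (suc N) refl)

  -- The prefix of length n − m is bounded by prefix-bound and the other m
  -- terms by w; the best choice is m − 1 = ⌊ (n − 1) n w / y ⌋.
  quadratic-bound : .{{_ : NonZero y}} → W ≤ y → y * y + W * W ≤ 2 * (S * y)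
  quadratic-bound W≤y = ℕ.*-cancelˡ-≤ C {{ℕ.m*n≢0 (suc N) N}} (begin
    C * (y * y + W * W)                 ≡⟨ a₁ N y w ⟩
    C * y * y + (a * a + a * W)         ≤⟨ ℕ.+-cancelʳ-≤ (q * suc q * (y * y)) _ _ (begin
      C * y * y + (a * a + a * W) + q * suc q * (y * y)
        ≡⟨ a₂ (C * y * y) (a * a + a * W) (q * suc q * (y * y)) ⟩
      C * y * y + (q * suc q * (y * y) + (a * a + a * W))
        ≤⟨ ℕ.+-monoʳ-≤ (C * y * y) floor ⟩
      C * y * y + 2 * suc q * a * y
        ≡⟨ a₃ N y w q ⟩
      (C * y + 2 * C * (suc q * w)) * y
        ≤⟨ ℕ.*-monoˡ-≤ y (ℕ.+-monoˡ-≤ (2 * C * (suc q * w)) (prefix-bound k q k+q)) ⟩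
      (2 * (C * P k) + suc q * q * y + 2 * C * (suc q * w)) * y
        ≡⟨ a₄ C y (P k) q (suc q * w) ⟩
      2 * C * (P k + suc q * w) * y + q * suc q * (y * y)
        ≤⟨ ℕ.+-monoˡ-≤ (q * suc q * (y * y)) (ℕ.*-monoˡ-≤ y (ℕ.*-monoʳ-≤ (2 * C) (suffix-bound k (suc q) k+q))) ⟩
      2 * C * S * y + q * suc q * (y * y) ∎) ⟩
    2 * C * S * y                       ≡⟨ a₅ C S y ⟩
    C * (2 * (S * y))                   ∎)
    where
    open ℕ.≤-Reasoning
    a = N * W
    q = a / y
    r = a % y
    a≡ : a ≡ r + q * y
    a≡ = m≡m%n+[m/n]*n a y
    -- This keeps the suffix of length `suc q` within the `suc N` ranks.
    q≤N : q ≤ N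
    q≤N = ℕ.*-cancelʳ-≤ q N y (begin
      q * y       ≤⟨ ℕ.m≤n+m (q * y) r ⟩
      r + q * y   ≡⟨ a≡ ⟨
      N * W       ≤⟨ ℕ.*-monoʳ-≤ N W≤y ⟩
      N * y       ∎)
    k = N ∸ q
    k+q : k + suc q ≡ suc N
    k+q = trans (ℕ.+-suc k q) (cong suc (ℕ.m∸n+n≡m q≤N))
    -- After W is replaced by y, the inequality says (a - q y)(a - (q + 1) y) ≤ 0, which holds
    -- because q is the integer part of a / y.
    floor : q * suc q * (y * y) + (a * a + a * W) ≤ 2 * suc q * a * y
    floor = begin
      q * suc q * (y * y) + (a * a + a * W)   ≤⟨ ℕ.+-monoʳ-≤ (q * suc q * (y * y)) (ℕ.+-monoʳ-≤ (a * a) (ℕ.*-monoʳ-≤ a W≤y)) ⟩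
      q * suc q * (y * y) + (a * a + a * y)   ≡⟨ cong (λ a → q * suc q * (y * y) + (a * a + a * y)) a≡ ⟩
      q * suc q * (y * y) + ((r + q * y) * (r + q * y) + (r + q * y) * y) ≡⟨ b₁ q y r ⟩
      R + r * r                               ≤⟨ ℕ.+-monoʳ-≤ R (ℕ.*-monoʳ-≤ r (ℕ.<⇒≤ (m%n<n a y))) ⟩
      R + r * y                               ≡⟨ b₂ q y r ⟩
      2 * suc q * (r + q * y) * y             ≡⟨ cong (λ a → 2 * suc q * a * y) a≡ ⟨
      2 * suc q * a * y                       ∎
      where
      R = 2 * q * (1 + q) * (y * y) + (2 * q + 1) * (r * y)
      b₁ : ∀ q y r → q * suc q * (y * y) + ((r + q * y) * (r + q * y) + (r + q * y) * y) ≡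
                     2 * q * (1 + q) * (y * y) + (2 * q + 1) * (r * y) + r * r
      b₁ = solve-∀
      b₂ : ∀ q y r → 2 * q * (1 + q) * (y * y) + (2 * q + 1) * (r * y) + r * y ≡ 2 * suc q * (r + q * y) * y
      b₂ = solve-∀
    a₁ : ∀ N y w → suc N * N * (y * y + suc N * w * (suc N * w)) ≡
         suc N * N * y * y + (N * (suc N * w) * (N * (suc N * w)) + N * (suc N * w) * (suc N * w))
    a₁ = solve-∀
    a₂ : ∀ a b c → a + b + c ≡ a + (c + b)
    a₂ = solve-∀
    a₃ : ∀ N y w q → suc N * N * y * y + 2 * suc q * (N * (suc N * w)) * y ≡
         (suc N * N * y + 2 * (suc N * N) * (suc q * w)) * y
    a₃ = solve-∀
    a₄ : ∀ C y p q v → (2 * (C * p) + suc q * q * y + 2 * C * v) * y ≡ 2 * C * (p + v) * y + q * suc q * (y * y)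
    a₄ = solve-∀
    a₅ : ∀ C S y → 2 * C * S * y ≡ C * (2 * (S * y))
    a₅ = solve-∀

  -- A ratio of at least 2/3 is above the bound already. Otherwise W ≤ S ≤ y and y > 0, as
  -- `quadratic-bound` requires, and 2 y - 3 S is a true difference.
  linear-program : 2 * y ≤ 2 * W + 3 * S → RatioAtLeastBound S y
  linear-program boundary with 2 * y ℕ.≤? 3 * S
  ... | yes 2y≤3S = ratio-≤ {y} {S} 2y≤3S
  ... | no 2y≰3S = ratio-quadratic {y} {S} {W} (ℕ.m+[n∸m]≡n 3S≤2y)
      (ℕ.m≤n+o⇒m∸n≤o (2 * y) (3 * S) (ℕ.≤-trans boundary (ℕ.≤-reflexive (ℕ.+-comm (2 * W) (3 * S)))))
      (quadratic-bound {{>-nonZero 0<y}} (ℕ.≤-trans last-bound S≤y))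
    where
    3S≤2y : 3 * S ≤ 2 * y
    3S≤2y = ℕ.<⇒≤ (ℕ.≰⇒> 2y≰3S)
    S≤y : S ≤ y
    S≤y = ℕ.*-cancelˡ-≤ 2 (ℕ.≤-trans (ℕ.*-monoˡ-≤ S {2} {3} (ℕ.m≤m+n 2 1)) 3S≤2y)
    0<y : 0 < y
    0<y = ℕ.*-cancelˡ-< 2 0 y (ℕ.≤-<-trans z≤n (ℕ.≰⇒> 2y≰3S))

-- The approximation ratio.

ratio : ∀ {N} (G : Graph (2 + N)) (I : Pairing G) →
        RatioAtLeastBound (totalMatched G) (length (permutations (2 + N)) * Σ (⟦_⟧ ∘ Pairing.covered I))
ratio {N} G I = subst (λ k → RatioAtLeastBound k total) (trans (prefix-all x) total-Σ)
  (linear-program (suc N) (prefix x) {total} {x last} evolve low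
    (subst (λ k → 2 * total ≤ 2 * ((2 + N) * x last) + 3 * k) (sym (prefix-all x)) boundary))
  where
  open Program I
  index : ∀ k m → k + suc m ≡ 2 + N → ∃ λ (t : Fin (2 + N)) → toℕ t ≡ k
  index k m eq = Fin.fromℕ< k<n , Fin.toℕ-fromℕ< k<n
    where
    k<n : k < 2 + N
    k<n = subst (k <_) eq (ℕ.m<m+n k (s≤s z≤n))
  low : ∀ k m → k + suc m ≡ 2 + N → prefix x k + x last ≤ prefix x (suc k)
  low k m eq with index k m eq
  ... | t , refl = ℕ.≤-trans (ℕ.+-monoʳ-≤ (prefix x (toℕ t)) (x-last t)) (ℕ.≤-reflexive (sym (prefix-suc x t)))
  evolve : ∀ k m → k + suc m ≡ 2 + N →
           total + suc m * prefix x k ≤ suc m * prefix x (suc k) + 2 * prefix x k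
  evolve k m eq with index k m eq
  ... | t , refl = begin
    total + suc m * p                           ≤⟨ ℕ.+-monoˡ-≤ (suc m * p) (evolving t) ⟩
    Σ later * x t + (p + p) + suc m * p         ≡⟨ cong (λ c → c * x t + (p + p) + suc m * p) count ⟩
    suc m * x t + (p + p) + suc m * p           ≡⟨ arith (suc m) (x t) p ⟩
    suc m * (p + x t) + 2 * p                   ≡⟨ cong (λ q → suc m * q + 2 * p) (prefix-suc x t) ⟨
    suc m * prefix x (suc (toℕ t)) + 2 * p      ∎
    where
    open ℕ.≤-Reasoning
    p = prefix x (toℕ t)
    later : Fin (2 + N) → ℕ
    later i = ⟦ not (below i (toℕ t)) ⟧
    count : Σ later ≡ suc m
    count = ℕ.+-cancelʳ-≡ (toℕ t) _ _ (trans (count-not-below (2 + N) (toℕ t) (ℕ.<⇒≤ (Fin.toℕ<n t)))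
      (trans (sym eq) (ℕ.+-comm (toℕ t) (suc m))))
    arith : ∀ c a p → c * a + (p + p) + c * p ≡ c * (p + a) + 2 * p
    arith = solve-∀

covered-count : ∀ {n} {G : Graph n} {M} → IsMatching G M →
                Σ (⟦_⟧ ∘ Pairing.covered (matching⇒pairing {G = G} M)) ≡ coveredNodes M
covered-count {n} {G} {M} (edges , unique) = sym (trans
  (cong (_+ coveredNodes M) (sym (Σ-zero {n} (λ _ → refl))))
  (run-matching {G = G} M {∅} (All.map (λ { {_ , _} p → p }) edges) unique (All.universal (λ _ → refl) _)))

theorem1 : (n : ℕ) (G : Graph n) → HasEdge G →
    (M : List (Fin n × Fin n)) → IsMaximumMatching G M →
    RatioAtLeastBound (totalMatched G) (length (permutations n) * coveredNodes M)
-- An edge needs two nodes; from there on n (n - 1), by which the linear program is scaled, is not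
-- zero.
theorem1 zero          G (() , _)
theorem1 (suc zero)    G (Fin.zero , Fin.zero , uv) = true≢false uv (adj-irrefl G Fin.zero)
theorem1 (suc (suc N)) G _ M (matching , _) =
  subst (λ c → RatioAtLeastBound (totalMatched G) (length (permutations (2 + N)) * c))
    (covered-count matching) (ratio G (matching⇒pairing M))
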